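{- Let $\Pi$ be a positroid variety in the Grassmannian $\mathrm{Gr}(k,n)$. For each projected Deodhar parametrization of $\Pi$, there is a bridge graph whose bridge graph parametrization is the same map (i.e. sends each parameter tuple to the same point of $\mathrm{Gr}(k,n)$). Conversely, every bridge graph parametrization of $\Pi$ agrees with some projected Deodhar parametrization of $\Pi$.
   Context: A positroid variety $\Pi\subseteq \mathrm{Gr}(k,n)$ is the Zariski closure of a positroid cell of the totally nonnegative Grassmannian; equivalently it is the image $\pi_k(X_u^w)$ of a Richardson variety under the projection $\pi_k:\mathcal{F}\ell(n)\to\mathrm{Gr}(k,n)$, for $u\le_k w$ in $k$-Bruhat order. A parametrization of $\Pi$ of dimension $d$ is a regular map $(\mathbb{C}^\times)^d\to\Pi$ which is birational onto a dense subset of $\Pi$. Bridge graph parametrization: a bridge graph is a plabic graph built from a lollipop graph (corresponding to a $k$-subset $u([k])$) by successively adding bridges $(a_1,b_1),\dots,(a_d,b_d)$, each step being an inversion of the current bounded affine permutation with all boundary vertices strictly between $a_r,b_r$ being lollipops. Giving bridge $r$ weight $t_r$ and all other edges weight $1$, the parametrization sends $(t_1,\dots,t_d)$ to the row span of the $k\times n$ matrix with an identity in columns $u([k])$ and zeros elsewhere, multiplied on the right by $x_{(a_1,b_1)}(\pm t_1)\cdots x_{(a_d,b_d)}(\pm t_d)$, where $x_{(a,b)}(t)$ is the elementary matrix with entry $t$ in position $(a,b)$ and the sign is negative iff $|u([k])\cap[a_r+1,b_r-1]|$ is odd. Projected Deodhar parametrization: for $u\le_k w$, a reduced word $\mathbf{w}=s_{i_1}\cdots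 s_{i_m}$ for $w$, and $\mathbf{u}$ the positive distinguished subexpression (PDS) for $u$ in $\mathbf{w}$, the Marsh–Rietsch parametrization of the Deodhar component is $g_m\cdots g_1$ with $g_j=x_{i_j}(t_j)$ if $s_{i_j}\notin\mathbf{u}$ and $g_j=\dot{s}_{i_j}^{ -1}$ if $s_{i_j}\in\mathbf{u}$; composing with the projection to $\mathrm{Gr}(k,n)$ (taking the first $k$ rows) gives a parametrization of $\Pi=\Pi_{\langle u,w\rangle_k}$. -}

module Defs where

open import Level using (Level; _⊔_)
open import Data.Nat as ℕ using (ℕ; zero; suc)
open import Data.Bool using (Bool; true; false; if_then_else_; _∧_; not)
open import Data.Fin as Fin using (Fin; zero; suc; toℕ; inject₁; inject≤; opposite; cast)
open import Data.Fin.Properties using (any?)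
open import Data.Fin.Permutation.Components using (transpose)
open import Data.List using (List; []; _∷_; length)
open import Data.Product using (Σ; ∃; _×_; _,_; proj₁; proj₂)
open import Data.Sum using (_⊎_)
open import Data.Unit using (⊤)
open import Function using (_∘_; id)
open import Relation.Nullary using (¬_; does)
open import Relation.Binary.PropositionalEquality using (_≡_)
open import Algebra.Bundles using (CommutativeRing)

-- Base field: an algebraically closed field of characteristic zero
-- (standing in for ℂ).

module _ {c ℓ : Level} (R : CommutativeRing c ℓ) where
  open CommutativeRing R using (Carrier; _+_; _*_; 0#; 1#)
  natCast : ℕ → Carrier
  natCast zero    = 0#
  natCast (suc n) = 1# + natCast n
  -- Horner evaluation of the MONIC polynomial with lower coefficients
  -- (a₀ ∷ a₁ ∷ … ∷ a_{d-1}), i.e. a₀ + x (a₁ + x ( … + x · 1)).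
  monicEval : List Carrier → Carrier → Carrier
  monicEval []       x = 1#
  monicEval (a ∷ as) x = a + x * monicEval as x

record ACField₀ (c ℓ : Level) : Set (Level.suc (c ⊔ ℓ)) where
  field
    cring : CommutativeRing c ℓ
  open CommutativeRing cring using (Carrier; _≈_; _*_; 0#; 1#)
  field
    1≉0        : ¬ (1# ≈ 0#)
    inverse    : ∀ x → ¬ (x ≈ 0#) → ∃ λ y → x * y ≈ 1#
    char-zero  : ∀ n → ¬ (natCast cring (suc n) ≈ 0#)
    alg-closed : ∀ (a : Carrier) (as : List Carrier) → ∃ λ x → monicEval cring (a ∷ as) x ≈ 0#

countFin : ∀ {n} → (Fin n → Bool) → ℕ
countFin {zero}  p = 0
countFin {suc n} p = (if p zero then 1 else 0) ℕ.+ countFin (p ∘ suc)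

sumFin : ∀ {n} → (Fin n → ℕ) → ℕ
sumFin {zero}  f = 0
sumFin {suc n} f = f zero ℕ.+ sumFin (f ∘ suc)

-- Permutations of Fin n (0-based positions), as functions.
-- Composition p ∘ q is the product pq; right multiplication by a
-- transposition swaps positions.

Perm : ℕ → Set
Perm n = Fin n → Fin n

ℓ : ∀ {n} → Perm n → ℕ
ℓ p = sumFin λ i → countFin λ j → does (i Fin.<? j) ∧ does (p j Fin.<? p i)

s : ∀ {m} → Fin m → Perm (suc m)
s i = transpose (inject₁ i) (suc i)

wordProd : ∀ {m} → List (Fin m) → Perm (suc m)
wordProd []       = id
wordProd (i ∷ is) = s i ∘ wordProd is

-- k-Bruhat order (Bergeron–Sottile): reflexive–transitive closure of the
-- covers  v ⋖_k v·(a b)  with a < k ≤ b (0-based; i.e. a ≤ k < b 1-based)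
-- and ℓ(v·(a b)) = ℓ(v) + 1.
data _≤[_]_ {n} (u : Perm n) (k : ℕ) : Perm n → Set where
  ≤k-refl : ∀ {w} → (∀ i → u i ≡ w i) → u ≤[ k ] w
  ≤k-step : ∀ {v w} (a b : Fin n) → u ≤[ k ] v →
            toℕ a ℕ.< k → k ℕ.≤ toℕ b →
            ℓ (v ∘ transpose a b) ≡ suc (ℓ v) →
            (∀ i → w i ≡ v (transpose a b i)) → u ≤[ k ] w

-- Expressions with a marked subexpression: a list of letters i_j
-- (j = 1,…,r from left to right), each flagged true iff s_{i_j} ∈ 𝐮.

Expr : ℕ → Set
Expr m = List (Fin m × Bool)

word : ∀ {m} → Expr m → List (Fin m)
word []            = []
word ((i , _) ∷ e) = i ∷ word e

subProdFrom : ∀ {m} → Perm (suc m) → Expr m → Perm (suc m)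
subProdFrom v []                = v
subProdFrom v ((i , true)  ∷ e) = subProdFrom (v ∘ s i) e
subProdFrom v ((i , false) ∷ e) = subProdFrom v e

-- positivity (Marsh–Rietsch): v_{(j-1)} < v_{(j-1)} s_{i_j} for all j,
-- where v_{(j)} are the partial products of the subexpression
PositiveFrom : ∀ {m} → Perm (suc m) → Expr m → Set
PositiveFrom v []            = ⊤
PositiveFrom v ((i , b) ∷ e) =
  ℓ v ℕ.< ℓ (v ∘ s i) × PositiveFrom (if b then v ∘ s i else v) e

IsPDS : ∀ {m} → Expr m → Perm (suc m) → Set
IsPDS e u = PositiveFrom id e × (∀ i → subProdFrom id e i ≡ u i)

nParams : ∀ {m} → Expr m → ℕ
nParams []                = 0
nParams ((_ , true)  ∷ e) = nParams e
nParams ((_ , false) ∷ e) = suc (nParams e)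

-- Data of a projected Deodhar parametrization of Π_{⟨u,w⟩_k} ⊆ Gr(k, m+1)
record DeodharDatum (m k : ℕ) : Set where
  field
    u w     : Perm (suc m)
    u≤kw    : u ≤[ k ] w
    expr    : Expr m
    isWord  : ∀ i → wordProd (word expr) i ≡ w i
    reduced : length (word expr) ≡ ℓ w
    pds     : IsPDS expr u

-- Bridge graphs in Gr(k,n).
-- Bounded affine permutations are recorded by their values on
-- positions 0,…,n-1, f : Fin n → ℕ with i ≤ f i ≤ i + n.

_∈img_ : ∀ {k n} → Fin n → (Fin k → Fin n) → Bool
c ∈img I = does (any? λ r → I r Fin.≟ c)

lollipop : ∀ {k n} → (Fin k → Fin n) → Fin n → ℕ
lollipop {n = n} I c = if c ∈img I then toℕ c ℕ.+ n else toℕ c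

-- validity of successively adding bridges (a_r, b_r) to the graph with
-- bounded affine permutation f: a < b, (a,b) is an inversion of f, all
-- boundary vertices strictly between a and b are lollipops, and the new
-- bounded affine permutation is f ∘ (a b).
ValidBridges : ∀ {n} → (Fin n → ℕ) → List (Fin n × Fin n) → Set
ValidBridges f [] = ⊤
ValidBridges {n} f ((a , b) ∷ bs) =
  a Fin.< b × f b ℕ.< f a ×
  (∀ c → a Fin.< c → c Fin.< b → f c ≡ toℕ c ⊎ f c ≡ toℕ c ℕ.+ n) ×
  ValidBridges (f ∘ transpose a b) bs

record BridgeGraph (n k : ℕ) : Set where
  field
    I          : Fin k → Fin n          -- the k-subset u([k]), listed increasingly
    increasing : ∀ r r′ → r Fin.< r′ → I r Fin.< I r′
    bridges    : List (Fin n × Fin n)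
    valid      : ValidBridges (lollipop I) bridges

module Param {c ℓ′} (F : ACField₀ c ℓ′) where
  open CommutativeRing (ACField₀.cring F) using (Carrier; _≈_; _+_; _*_; -_; 0#; 1#)

  Mat : ℕ → ℕ → Set c
  Mat r q = Fin r → Fin q → Carrier

  Σ[_] : ∀ {n} → (Fin n → Carrier) → Carrier
  Σ[_] {zero}  f = 0#
  Σ[_] {suc n} f = f zero + Σ[ f ∘ suc ]

  infixl 7 _·_
  _·_ : ∀ {r p q} → Mat r p → Mat p q → Mat r q
  (A · B) i j = Σ[ (λ l → A i l * B l j) ]

  1M : ∀ {n} → Mat n n
  1M i j = if does (i Fin.≟ j) then 1# else 0#

  xE : ∀ {n} → Fin n → Fin n → Carrier → Mat n n
  xE a b t i j = if does (i Fin.≟ a) ∧ does (j Fin.≟ b) then t else 1M i j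

  xs : ∀ {m} → Fin m → Carrier → Mat (suc m) (suc m)
  xs i t = xE (inject₁ i) (suc i) t

  -- ṡ_i⁻¹, where ṡ_i = x_i(-1) y_i(1) x_i(-1) has block [[0,-1],[1,0]]
  -- in rows/columns i,i+1; so ṡ_i⁻¹ has block [[0,1],[-1,0]].
  ṡ⁻¹ : ∀ {m} → Fin m → Mat (suc m) (suc m)
  ṡ⁻¹ i p q =
    if does (p Fin.≟ a) ∧ does (q Fin.≟ b) then 1# else
    if does (p Fin.≟ b) ∧ does (q Fin.≟ a) then - 1# else
    if not (does (p Fin.≟ a)) ∧ not (does (p Fin.≟ b)) then 1M p q else 0#
    where a = inject₁ i
          b = suc i

  -- Marsh–Rietsch product g_r ⋯ g_1 for the expression e = (g_1, …, g_r);
  -- the parameters are t_j for the letters j ∉ 𝐮, indexed in increasing j.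
  deodharMat : ∀ {m} (e : Expr m) → (Fin (nParams e) → Carrier) → Mat (suc m) (suc m)
  deodharMat []                t = 1M
  deodharMat ((i , true)  ∷ e) t = deodharMat e t · ṡ⁻¹ i
  deodharMat ((i , false) ∷ e) t = deodharMat e (t ∘ suc) · xs i (t zero)

  -- projection to Gr(k,n): first k rows
  firstRows : ∀ {k n} → k ℕ.≤ n → Mat n n → Mat k n
  firstRows k≤n M r q = M (inject≤ r k≤n) q

  projDeodhar : ∀ {m k} → k ℕ.≤ suc m → (D : DeodharDatum m k) →
                (Fin (nParams (DeodharDatum.expr D)) → Carrier) → Mat k (suc m)
  projDeodhar k≤n D t = firstRows k≤n (deodharMat (DeodharDatum.expr D) t)

  lollipopMat : ∀ {k n} → (Fin k → Fin n) → Mat k n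
  lollipopMat I r q = if does (I r Fin.≟ q) then 1# else 0#

  oddBetween : ∀ {k n} → (Fin k → Fin n) → Fin n → Fin n → Bool
  oddBetween I a b = isOdd (countFin λ r → does (a Fin.<? I r) ∧ does (I r Fin.<? b))
    where
      isOdd : ℕ → Bool
      isOdd zero          = false
      isOdd (suc zero)    = true
      isOdd (suc (suc n)) = isOdd n

  bridgeProd : ∀ {k n} → (Fin k → Fin n) → (bs : List (Fin n × Fin n)) →
               (Fin (length bs) → Carrier) → Mat n n
  bridgeProd I []             t = 1M
  bridgeProd I ((a , b) ∷ bs) t =
    xE a b (if oddBetween I a b then - t zero else t zero) · bridgeProd I bs (t ∘ suc)

  bridgeMat : ∀ {n k} (B : BridgeGraph n k) →
              (Fin (length (BridgeGraph.bridges B)) → Carrier) → Mat k n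
  bridgeMat B t = lollipopMat I · bridgeProd I (BridgeGraph.bridges B) t
    where I = BridgeGraph.I B

  -- equality of the points of Gr(k,n): equal row spans
  SameRowSpan : ∀ {k n} → Mat k n → Mat k n → Set (c ⊔ ℓ′)
  SameRowSpan A B =
    (∃ λ (G : Mat _ _) → ∀ i j → (G · B) i j ≈ A i j) ×
    (∃ λ (H : Mat _ _) → ∀ i j → (H · A) i j ≈ B i j)

  NonZero : ∀ {d} → (Fin d → Carrier) → Set ℓ′
  NonZero t = ∀ j → ¬ (t j ≈ 0#)

  -- The projected Deodhar parametrization of D and the bridge graph
  -- parametrization of B are the same map (ℂ^×)^d → Gr(k,n), where the
  -- r-th bridge parameter is identified with the r-th Deodhar parameter
  -- counted from the END of the word (i.e. in the order of the factors
  -- in the product g_r ⋯ g_1).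
  SameMap : ∀ {m k} → (k≤n : k ℕ.≤ suc m) → DeodharDatum m k → BridgeGraph (suc m) k → Set (c ⊔ ℓ′)
  SameMap k≤n D B =
    Σ (length (BridgeGraph.bridges B) ≡ nParams (DeodharDatum.expr D)) λ eq →
      ∀ (t : Fin (nParams (DeodharDatum.expr D)) → Carrier) → NonZero t →
        SameRowSpan (projDeodhar k≤n D t) (bridgeMat B (t ∘ cast eq ∘ opposite))

{-# OPTIONS --safe #-}
module Submission where

-- Read the word of a Deodhar datum letter by letter, with v the partial product of the subexpression 𝐮.
-- Moving every ṡᵢ⁻¹ to the left turns xᵢ(t) into x₍ₐ,ᵦ₎(±t) with (a , b) = (v i , v (i+1)), so the matrix becomes a
-- signed permutation matrix of u times a product of bridge factors, the last letter giving the first bridge.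
-- These bridges are valid, with the signs prescribed by u([k]), because of one invariant between v and the
-- current bounded affine permutation f: whenever c stands before d in v and c > d, either f c = c + n or f d = d.
-- It holds at the start, where f is a lollipop, and is kept by every letter; applied to the pairs (c , a) and
-- (b , c) it says that each c strictly between a and b is a lollipop, and that c ∈ u([k]) exactly when c stands
-- before a.  The inequality f b < f a holds since u ≤ₖ w forces the inversions of w to be inversions of u or
-- to straddle k.
--
-- Conversely, read the bridges backwards from v = id.  The same invariant shows that everything standing between
-- a and b is a lollipop and can be moved out of the way, so a and b become neighbours and the letter of the bridge
-- can be read; finally the lollipops c with f c = c + n are moved to the first k positions.  That u ≤ₖ w for
-- the resulting pair follows from the Bergeron–Sottile criterion, whose hypotheses are the boundedness of f
-- and the inclusion of inversions.

open import Defs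
open import Level using (Level)
open import Algebra.Bundles using (CommutativeRing)
open import Data.Bool using (Bool; true; false; if_then_else_; _∧_; _∨_; not)
import Data.Bool.Properties as Boolₚ
open import Data.Empty using (⊥-elim)
open import Data.Fin as Fin using (Fin; zero; suc; toℕ; inject₁; inject≤; opposite; cast)
open import Data.Fin.Permutation.Components using (transpose; transpose-inverse)
import Data.Fin.Properties as Finₚ
open import Data.List using (List; []; _∷_; length; _∷ʳ_)
import Data.List.Properties as Listₚ
open import Data.List.Reverse using (Reverse; []; _∶_∶ʳ_; reverseView)
open import Data.Nat as ℕ using (ℕ; zero; suc; _+_; _*_; _∸_; _≤_; _<_; z≤n; s≤s)
import Data.Nat.Properties as ℕₚ
open import Algebra.Properties.CommutativeSemigroup ℕₚ.+-commutativeSemigroup using (interchange; x∙yz≈y∙xz)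
open import Data.Product using (∃; _×_; _,_; proj₁; proj₂)
open import Data.Sum using (_⊎_; inj₁; inj₂; [_,_]′)
open import Data.Unit using (⊤)
open import Function using (_∘_; id; mk⇔)
open import Relation.Binary using (tri<; tri≈; tri>)
open import Relation.Binary.PropositionalEquality using (_≡_; _≢_; _≗_; refl; sym; trans; cong; cong₂; subst; subst₂)
open import Relation.Nullary using (¬_; Dec; yes; no; does; contradiction)
open import Relation.Nullary.Decidable using (dec-true; dec-false; does-⇔; toSum; _→-dec_; _×-dec_; ¬?)

-- `Perm n` is a bare function type, so injectivity is carried as a separate hypothesis.
Inj : ∀ {n N} → (Fin n → Fin N) → Set
Inj p = ∀ {x y} → p x ≡ p y → x ≡ y

-- Transpositions

transpose-left : ∀ {n} (a b : Fin n) → transpose a b a ≡ b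
transpose-left a b rewrite dec-true (a Fin.≟ a) refl = refl

transpose-right : ∀ {n} (a b : Fin n) → transpose a b b ≡ a
transpose-right a b with b Fin.≟ a
... | yes b≡a = b≡a
... | no _ rewrite dec-true (b Fin.≟ b) refl = refl

transpose-other : ∀ {n} (a b : Fin n) {x} → x ≢ a → x ≢ b → transpose a b x ≡ x
transpose-other a b {x} x≢a x≢b rewrite dec-false (x Fin.≟ a) x≢a | dec-false (x Fin.≟ b) x≢b = refl

data TransposeView {n} (a b x : Fin n) : Set where
  isLeft  : x ≡ a → TransposeView a b x
  isRight : x ≡ b → TransposeView a b x
  isOther : x ≢ a → x ≢ b → TransposeView a b x

transposeView : ∀ {n} (a b x : Fin n) → TransposeView a b x
transposeView a b x with x Fin.≟ a
... | yes p = isLeft p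
... | no p with x Fin.≟ b
...   | yes q = isRight q
...   | no q = isOther p q

transpose-comm : ∀ {n} (a b x : Fin n) → transpose a b x ≡ transpose b a x
transpose-comm a b x with transposeView a b x
... | isLeft refl  = trans (transpose-left a b) (sym (transpose-right b a))
... | isRight refl = trans (transpose-right a b) (sym (transpose-left b a))
... | isOther p q  = trans (transpose-other a b p q) (sym (transpose-other b a q p))

transpose-involutive : ∀ {n} (a b x : Fin n) → transpose a b (transpose a b x) ≡ x
transpose-involutive a b x = trans (cong (transpose a b) (transpose-comm a b x)) (transpose-inverse a b)

transpose-injective : ∀ {n} (a b : Fin n) → Inj (transpose a b)
transpose-injective a b {x} {y} eq =
  trans (sym (transpose-involutive a b x)) (trans (cong (transpose a b) eq) (transpose-involutive a b y))

∘-transpose-injective : ∀ {n N} {v : Fin n → Fin N} (a b : Fin n) → Inj v → Inj (v ∘ transpose a b)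
∘-transpose-injective a b v-inj = transpose-injective a b ∘ v-inj

inject₁<suc : ∀ {m} (i : Fin m) → inject₁ i Fin.< suc i
inject₁<suc i = s≤s (ℕₚ.≤-reflexive (Finₚ.toℕ-inject₁ i))

s-left : ∀ {m} (i : Fin m) → s i (inject₁ i) ≡ suc i
s-left i = transpose-left (inject₁ i) (suc i)

s-right : ∀ {m} (i : Fin m) → s i (suc i) ≡ inject₁ i
s-right i = transpose-right (inject₁ i) (suc i)

s-involutive : ∀ {m} (i : Fin m) (x : Fin (suc m)) → s i (s i x) ≡ x
s-involutive i = transpose-involutive (inject₁ i) (suc i)

s-suc : ∀ {m} (i : Fin m) (x : Fin (suc m)) → s (suc i) (suc x) ≡ suc (s i x)
s-suc i x with transposeView (inject₁ i) (suc i) x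
... | isLeft refl  = trans (s-left (suc i)) (cong suc (sym (s-left i)))
... | isRight refl = trans (s-right (suc i)) (cong suc (sym (s-right i)))
... | isOther p q  = trans (transpose-other (suc (inject₁ i)) (suc (suc i)) (p ∘ Finₚ.suc-injective) (q ∘ Finₚ.suc-injective))
                           (cong suc (sym (transpose-other _ _ p q)))

-- No position lies strictly between `inject₁ i` and `suc i`, so exchanging them changes the order
-- of no other pair. Inversion conditions are transported across a letter through this dichotomy.
s-mono : ∀ {m} (i : Fin m) {x y : Fin (suc m)} → x Fin.< y →
         (x ≡ inject₁ i × y ≡ suc i) ⊎ s i x Fin.< s i y
s-mono i {x} {y} x<y with transposeView (inject₁ i) (suc i) x | transposeView (inject₁ i) (suc i) y
... | isLeft refl | isLeft refl = contradiction x<y (ℕₚ.<-irrefl refl)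
... | isLeft p | isRight q = inj₁ (p , q)
... | isLeft refl | isOther y≢a y≢b rewrite s-left i | transpose-other (inject₁ i) (suc i) y≢a y≢b =
  inj₂ (ℕₚ.≤∧≢⇒< (subst (_< toℕ y) (Finₚ.toℕ-inject₁ i) x<y) (y≢b ∘ sym ∘ Finₚ.toℕ-injective))
... | isRight refl | isLeft refl = contradiction x<y (ℕₚ.<-asym (inject₁<suc i))
... | isRight refl | isRight refl = contradiction x<y (ℕₚ.<-irrefl refl)
... | isRight refl | isOther y≢a y≢b rewrite s-right i | transpose-other (inject₁ i) (suc i) y≢a y≢b =
  inj₂ (ℕₚ.<-trans (inject₁<suc i) x<y)
... | isOther x≢a x≢b | isLeft refl rewrite s-left i | transpose-other (inject₁ i) (suc i) x≢a x≢b =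
  inj₂ (ℕₚ.<-trans x<y (inject₁<suc i))
... | isOther x≢a x≢b | isRight refl rewrite s-right i | transpose-other (inject₁ i) (suc i) x≢a x≢b =
  inj₂ (ℕₚ.≤∧≢⇒< (subst (toℕ x ≤_) (sym (Finₚ.toℕ-inject₁ i)) (ℕₚ.≤-pred x<y)) (x≢a ∘ Finₚ.toℕ-injective))
... | isOther x≢a x≢b | isOther y≢a y≢b
  rewrite transpose-other (inject₁ i) (suc i) x≢a x≢b | transpose-other (inject₁ i) (suc i) y≢a y≢b = inj₂ x<y

-- Counting

countFin-cong : ∀ {n} {p q : Fin n → Bool} → p ≗ q → countFin p ≡ countFin q
countFin-cong {zero}  eq = refl
countFin-cong {suc n} eq = cong₂ _+_ (cong (if_then 1 else 0) (eq zero)) (countFin-cong (eq ∘ suc))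

sumFin-cong : ∀ {n} {f g : Fin n → ℕ} → f ≗ g → sumFin f ≡ sumFin g
sumFin-cong {zero}  eq = refl
sumFin-cong {suc n} eq = cong₂ _+_ (eq zero) (sumFin-cong (eq ∘ suc))

countFin-s : ∀ {m} (i : Fin m) (p : Fin (suc m) → Bool) → countFin (p ∘ s i) ≡ countFin p
countFin-s zero    p = x∙yz≈y∙xz (if p (suc zero) then 1 else 0) (if p zero then 1 else 0) _
countFin-s (suc i) p = cong ((if p zero then 1 else 0) +_) (trans (countFin-cong (cong p ∘ s-suc i)) (countFin-s i (p ∘ suc)))

countFin≤n : ∀ {n} (p : Fin n → Bool) → countFin p ≤ n
countFin≤n {zero}  p = z≤n
countFin≤n {suc n} p = ℕₚ.+-mono-≤ (ite≤1 (p zero)) (countFin≤n (p ∘ suc))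
  where
  ite≤1 : ∀ b → (if b then 1 else 0) ≤ 1
  ite≤1 true  = ℕₚ.≤-refl
  ite≤1 false = z≤n

sumFin≤ : ∀ {n} (f : Fin n → ℕ) {c} → (∀ i → f i ≤ c) → sumFin f ≤ n * c
sumFin≤ {zero}  f le = z≤n
sumFin≤ {suc n} f le = ℕₚ.+-mono-≤ (le zero) (sumFin≤ (f ∘ suc) (le ∘ suc))

-- Length

<?-true : ∀ {n} {x y : Fin n} → x Fin.< y → does (x Fin.<? y) ≡ true
<?-true {x = x} {y} = dec-true (x Fin.<? y)

<?-false : ∀ {n} {x y : Fin n} → ¬ x Fin.< y → does (x Fin.<? y) ≡ false
<?-false {x = x} {y} = dec-false (x Fin.<? y)

-- The formula of `ℓ` with a free codomain, so that the induction in `inversions-s` may pass from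
-- `p` to `p ∘ suc`.
inversions : ∀ {n N} → (Fin n → Fin N) → ℕ
inversions p = sumFin λ i → countFin λ j → does (i Fin.<? j) ∧ does (p j Fin.<? p i)

inversions-cong : ∀ {n N} {p q : Fin n → Fin N} → p ≗ q → inversions p ≡ inversions q
inversions-cong eq = sumFin-cong λ i → countFin-cong λ j →
  cong (does (i Fin.<? j) ∧_) (cong₂ (λ a b → does (a Fin.<? b)) (eq j) (eq i))

inversions≤n² : ∀ {n N} (p : Fin n → Fin N) → inversions p ≤ n * n
inversions≤n² p = sumFin≤ (λ i → countFin λ j → does (i Fin.<? j) ∧ does (p j Fin.<? p i)) λ _ → countFin≤n _

-- For `i = 0` the two leading rows trade places and their own pair is the one new inversion. For
-- larger `i` the row of position 0 keeps its count by `countFin-s`, and the rest is the induction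
-- hypothesis.
inversions-s : ∀ {m N} (p : Fin (suc m) → Fin N) (i : Fin m) → p (inject₁ i) Fin.< p (suc i) →
               inversions (p ∘ s i) ≡ suc (inversions p)
inversions-s p zero lt
  rewrite <?-true lt | <?-false (ℕₚ.<-asym lt) =
  cong suc (x∙yz≈y∙xz (countFin λ j → does (p (suc (suc j)) Fin.<? p (suc zero)))
                     (countFin λ j → does (p (suc (suc j)) Fin.<? p zero)) _)
inversions-s p (suc i) lt = trans
  (cong₂ _+_ (trans (countFin-cong λ j → cong (λ z → does (p z Fin.<? p zero)) (s-suc i j))
                    (countFin-s i λ j → does (p (suc j) Fin.<? p zero)))
             (trans (inversions-cong (cong p ∘ s-suc i)) (inversions-s (p ∘ suc) i lt)))
  (ℕₚ.+-suc _ _)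

ℓ-cong : ∀ {n} {v w : Perm n} → v ≗ w → ℓ v ≡ ℓ w
ℓ-cong = inversions-cong

ℓ-s-ascent : ∀ {m} (v : Perm (suc m)) (i : Fin m) → v (inject₁ i) Fin.< v (suc i) → ℓ (v ∘ s i) ≡ suc (ℓ v)
ℓ-s-ascent = inversions-s

ℓ-s-descent : ∀ {m} (v : Perm (suc m)) (i : Fin m) → v (suc i) Fin.< v (inject₁ i) → ℓ v ≡ suc (ℓ (v ∘ s i))
ℓ-s-descent v i gt = trans
  (ℓ-cong λ x → cong v (sym (s-involutive i x)))
  (ℓ-s-ascent (v ∘ s i) i (subst₂ Fin._<_ (sym (cong v (s-left i))) (sym (cong v (s-right i))) gt))

≢⇒<⊎> : ∀ {n} {x y : Fin n} → x ≢ y → x Fin.< y ⊎ y Fin.< x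
≢⇒<⊎> {x = x} {y} x≢y with Finₚ.<-cmp x y
... | tri< lt _ _ = inj₁ lt
... | tri≈ _ eq _ = contradiction eq x≢y
... | tri> _ _ gt = inj₂ gt

<⇒≢ : ∀ {n} {x y : Fin n} → x Fin.< y → x ≢ y
<⇒≢ lt refl = ℕₚ.<-irrefl refl lt

compare-at : ∀ {n N} {v : Fin n → Fin N} → Inj v → ∀ {x y} → x ≢ y → v x Fin.< v y ⊎ v y Fin.< v x
compare-at v-inj x≢y = ≢⇒<⊎> (x≢y ∘ v-inj)

ℓ-s-cases : ∀ {m} {v : Perm (suc m)} → Inj v → (i : Fin m) →
            (v (inject₁ i) Fin.< v (suc i) × ℓ (v ∘ s i) ≡ suc (ℓ v)) ⊎
            (v (suc i) Fin.< v (inject₁ i) × ℓ v ≡ suc (ℓ (v ∘ s i)))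
ℓ-s-cases {v = v} v-inj i with compare-at v-inj (<⇒≢ (inject₁<suc i))
... | inj₁ lt = inj₁ (lt , ℓ-s-ascent v i lt)
... | inj₂ gt = inj₂ (gt , ℓ-s-descent v i gt)

ℓ<⇒ascent : ∀ {m} {v : Perm (suc m)} → Inj v → (i : Fin m) → ℓ v < ℓ (v ∘ s i) → v (inject₁ i) Fin.< v (suc i)
ℓ<⇒ascent v-inj i lt with ℓ-s-cases v-inj i
... | inj₁ (asc , _) = asc
... | inj₂ (_ , eq) = contradiction lt (ℕₚ.<-asym (ℕₚ.≤-reflexive (sym eq)))

ascent⇒ℓ< : ∀ {m} (v : Perm (suc m)) (i : Fin m) → v (inject₁ i) Fin.< v (suc i) → ℓ v < ℓ (v ∘ s i)
ascent⇒ℓ< v i lt = ℕₚ.≤-reflexive (sym (ℓ-s-ascent v i lt))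

transpose-conjugate : ∀ {n} {a b c : Fin n} → a ≢ c → b ≢ c → a ≢ b → ∀ x →
                      transpose a c (transpose c b (transpose a c x)) ≡ transpose a b x
transpose-conjugate {a = a} {b} {c} a≢c b≢c a≢b x with transposeView a c x
... | isLeft refl rewrite transpose-left x c | transpose-left c b | transpose-other x c (a≢b ∘ sym) b≢c =
  sym (transpose-left x b)
... | isRight refl rewrite transpose-right a x | transpose-other x b a≢c a≢b | transpose-left a x =
  sym (transpose-other a b (a≢c ∘ sym) (b≢c ∘ sym))
... | isOther x≢a x≢c rewrite transpose-other a c x≢a x≢c with x Fin.≟ b
...   | yes refl rewrite transpose-right c x | transpose-right a c = sym (transpose-right a x)
...   | no x≢b rewrite transpose-other c b x≢c x≢b | transpose-other a c x≢a x≢c = sym (transpose-other a b x≢a x≢b)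

lower : ∀ {m} {a b : Fin (suc m)} → a Fin.< b → ∃ λ i → a ≡ inject₁ i
lower {m} {a} {b} a<b = Fin.fromℕ< a<m , Finₚ.toℕ-injective (trans (sym (Finₚ.toℕ-fromℕ< a<m)) (sym (Finₚ.toℕ-inject₁ _)))
  where
  a<m : toℕ a < m
  a<m = ℕₚ.<-≤-trans a<b (ℕₚ.≤-pred (Finₚ.toℕ<n b))

-- For `a < b` and `v a < v b` this is the classical condition for v (a b) to cover v in Bruhat
-- order.
NothingBetween : ∀ {n} → Perm n → Fin n → Fin n → Set
NothingBetween v a b = ∀ {c} → a Fin.< c → c Fin.< b → v a Fin.< v c → ¬ v c Fin.< v b

-- Induction on b − a, through (a b) = (a c)(c b)(a c) with c = a + 1.
ℓ-transpose-up : ∀ {m} d (v : Perm (suc m)) (a b : Fin (suc m)) → toℕ b ≡ d + suc (toℕ a) → Inj v → v a Fin.< v b →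
                 ℓ v < ℓ (v ∘ transpose a b) × (NothingBetween v a b → ℓ (v ∘ transpose a b) ≡ suc (ℓ v))
ℓ-transpose-up zero v a b eq v-inj va<vb with lower {a = a} {b} (ℕₚ.≤-reflexive (sym eq))
... | i , refl with Finₚ.toℕ-injective {i = b} {j = suc i} (trans eq (cong suc (Finₚ.toℕ-inject₁ i)))
...   | refl = ascent⇒ℓ< v i va<vb , λ _ → ℓ-s-ascent v i va<vb
ℓ-transpose-up {m} (suc d) v a b eq v-inj va<vb
  with lower {a = a} {b} (subst (toℕ a <_) (sym eq) (s≤s (ℕₚ.≤-trans (ℕₚ.n≤1+n _) (ℕₚ.m≤n+m _ d))))
... | i , refl = result
  where
  c : Fin (suc m)
  c = suc i
  toℕ-c : toℕ c ≡ suc (toℕ (inject₁ i))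
  toℕ-c = cong suc (sym (Finₚ.toℕ-inject₁ i))
  b≡ : toℕ b ≡ d + suc (toℕ c)
  b≡ = trans eq (trans (sym (ℕₚ.+-suc d _)) (cong (λ z → d + suc z) (sym toℕ-c)))
  c<b : c Fin.< b
  c<b = subst (toℕ c <_) (sym b≡) (ℕₚ.m≤n+m _ d)
  a<c : a Fin.< c
  a<c = inject₁<suc i
  v₁ v₂ : Perm (suc m)
  v₁ = v ∘ s i
  v₂ = v₁ ∘ transpose c b
  v₁c : v₁ c ≡ v a
  v₁c = cong v (s-right i)
  b≢a = <⇒≢ (ℕₚ.<-trans a<c c<b) ∘ sym
  b≢c = <⇒≢ c<b ∘ sym
  v₁-fixed : ∀ {x} → x ≢ a → x ≢ c → v₁ x ≡ v x
  v₁-fixed p q = cong v (transpose-other a c p q)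
  v₁b : v₁ b ≡ v b
  v₁b = v₁-fixed b≢a b≢c
  IH = ℓ-transpose-up d v₁ c b b≡ (∘-transpose-injective _ _ v-inj) (subst₂ Fin._<_ (sym v₁c) (sym v₁b) va<vb)
  v₂a : v₂ a ≡ v c
  v₂a = trans (cong v₁ (transpose-other c b (<⇒≢ a<c) (b≢a ∘ sym))) (cong v (s-left i))
  v₂c : v₂ c ≡ v b
  v₂c = trans (cong v₁ (transpose-left c b)) v₁b
  ℓ≡ : ℓ (v ∘ transpose a b) ≡ ℓ (v₂ ∘ s i)
  ℓ≡ = ℓ-cong λ x → cong v (sym (transpose-conjugate (<⇒≢ a<c) b≢c (b≢a ∘ sym) x))
  between : NothingBetween v a b → NothingBetween v₁ c b
  between nb {x} c<x x<b lt₁ lt₂ = nb (ℕₚ.<-trans a<c c<x) x<b (subst₂ Fin._<_ v₁c v₁x lt₁) (subst₂ Fin._<_ v₁x v₁b lt₂)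
    where v₁x = v₁-fixed (<⇒≢ (ℕₚ.<-trans a<c c<x) ∘ sym) (<⇒≢ c<x ∘ sym)
  last-up : v c Fin.< v b → ℓ (v ∘ transpose a b) ≡ suc (ℓ v₂)
  last-up lt = trans ℓ≡ (ℓ-s-ascent v₂ i (subst₂ Fin._<_ (sym v₂a) (sym v₂c) lt))
  last-down : v b Fin.< v c → ℓ v₂ ≡ suc (ℓ (v ∘ transpose a b))
  last-down gt = trans (ℓ-s-descent v₂ i (subst₂ Fin._<_ (sym v₂c) (sym v₂a) gt)) (cong suc (sym ℓ≡))
  -- If `v c` is below both values, the outer factors first lower and then raise the length; if it
  -- is above both, they first raise and then lower it. Only `v a < v c < v b` raises it twice, and
  -- that is what `NothingBetween` excludes.
  result : ℓ v < ℓ (v ∘ transpose a b) × (NothingBetween v a b → ℓ (v ∘ transpose a b) ≡ suc (ℓ v))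
  result with compare-at v-inj (<⇒≢ a<c)
  ... | inj₂ vc<va =
    subst₂ _<_ (sym (ℓ-s-descent v i vc<va)) (sym (last-up vc<vb)) (s≤s (proj₁ IH)) ,
    λ nb → trans (last-up vc<vb) (cong suc (trans (proj₂ IH (between nb)) (sym (ℓ-s-descent v i vc<va))))
    where vc<vb = ℕₚ.<-trans vc<va va<vb
  ... | inj₁ va<vc with compare-at v-inj (b≢c ∘ sym)
  ...   | inj₁ vc<vb =
    ℕₚ.<-trans (ascent⇒ℓ< v i va<vc) (ℕₚ.<-trans (proj₁ IH) (ℕₚ.≤-reflexive (sym (last-up vc<vb)))) ,
    λ nb → contradiction vc<vb (nb a<c c<b va<vc)
  ...   | inj₂ vb<vc =
    ℕₚ.≤-pred (subst₂ _<_ (ℓ-s-ascent v i va<vc) (last-down vb<vc) (proj₁ IH)) ,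
    λ nb → ℕₚ.suc-injective (trans (sym (last-down vb<vc)) (trans (proj₂ IH (between nb)) (cong suc (ℓ-s-ascent v i va<vc))))

<⇒∃+ : ∀ {a b} → a < b → ∃ λ d → b ≡ d + suc a
<⇒∃+ {a} {b} a<b = b ℕ.∸ suc a , sym (ℕₚ.m∸n+n≡m a<b)

ℓ-transpose-< : ∀ {m} (v : Perm (suc m)) {a b : Fin (suc m)} → Inj v → a Fin.< b → v a Fin.< v b →
                ℓ v < ℓ (v ∘ transpose a b)
ℓ-transpose-< v {a} {b} v-inj a<b va<vb = proj₁ (ℓ-transpose-up _ v a b (proj₂ (<⇒∃+ a<b)) v-inj va<vb)

ℓ-cover : ∀ {m} (v : Perm (suc m)) {a b : Fin (suc m)} → Inj v → a Fin.< b → v a Fin.< v b → NothingBetween v a b →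
          ℓ (v ∘ transpose a b) ≡ suc (ℓ v)
ℓ-cover v {a} {b} v-inj a<b va<vb = proj₂ (ℓ-transpose-up _ v a b (proj₂ (<⇒∃+ a<b)) v-inj va<vb)

cover⇒< : ∀ {m} (v : Perm (suc m)) {a b : Fin (suc m)} → Inj v → a Fin.< b → ℓ (v ∘ transpose a b) ≡ suc (ℓ v) → v a Fin.< v b
cover⇒< v {a} {b} v-inj a<b eq with compare-at v-inj (<⇒≢ a<b)
... | inj₁ lt = lt
... | inj₂ gt = contradiction (ℕₚ.≤-reflexive (sym eq)) (ℕₚ.<-asym (subst (ℓ (v ∘ transpose a b) <_)
  (ℓ-cong λ x → cong v (transpose-involutive a b x))
  (ℓ-transpose-< (v ∘ transpose a b) (∘-transpose-injective a b v-inj) a<b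
    (subst₂ Fin._<_ (sym (cong v (transpose-left a b))) (sym (cong v (transpose-right a b))) gt))))

-- If v a < v c < v b then (a b) = (a c)(c b)(a c) raises the length at least three times.
cover⇒nothingBetween : ∀ {m} (v : Perm (suc m)) {a b : Fin (suc m)} → Inj v → ℓ (v ∘ transpose a b) ≡ suc (ℓ v) →
                       NothingBetween v a b
cover⇒nothingBetween {m} v {a} {b} v-inj eq {c} a<c c<b va<vc vc<vb =
  ℕₚ.<-irrefl refl (ℕₚ.<-≤-trans (ℕₚ.<-trans (s≤s up₁) (ℕₚ.≤-<-trans up₂ up₃)) (ℕₚ.≤-reflexive (trans ℓ≡ eq)))
  where
  v₁ v₂ : Perm (suc m)
  v₁ = v ∘ transpose a c
  v₂ = v₁ ∘ transpose c b
  a<b = ℕₚ.<-trans a<c c<b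
  b≢a = <⇒≢ a<b ∘ sym
  b≢c = <⇒≢ c<b ∘ sym
  v₁b : v₁ b ≡ v b
  v₁b = cong v (transpose-other a c b≢a b≢c)
  v₁-inj = ∘-transpose-injective a c v-inj
  up₁ : ℓ v < ℓ v₁
  up₁ = ℓ-transpose-< v v-inj a<c va<vc
  up₂ : ℓ v₁ < ℓ v₂
  up₂ = ℓ-transpose-< v₁ v₁-inj c<b
    (subst₂ Fin._<_ (sym (cong v (transpose-right a c))) (sym v₁b) (ℕₚ.<-trans va<vc vc<vb))
  up₃ : ℓ v₂ < ℓ (v₂ ∘ transpose a c)
  up₃ = ℓ-transpose-< v₂ (∘-transpose-injective c b v₁-inj) a<c
    (subst₂ Fin._<_ (sym (trans (cong v₁ (transpose-other c b (<⇒≢ a<c) (b≢a ∘ sym))) (cong v (transpose-left a c))))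
                    (sym (trans (cong v₁ (transpose-left c b)) v₁b)) vc<vb)
  ℓ≡ : ℓ (v₂ ∘ transpose a c) ≡ ℓ (v ∘ transpose a b)
  ℓ≡ = ℓ-cong λ x → cong v (transpose-conjugate (<⇒≢ a<c) b≢c (b≢a ∘ sym) x)

-- k-Bruhat order

-- The Bergeron-Sottile condition in contrapositive form: for two positions on the same side of `k`,
-- an ascent of `u` stays an ascent of `w`.
InvBound : ∀ {n} → ℕ → Perm n → Perm n → Set
InvBound k u w = ∀ {x y} → x Fin.< y → w y Fin.< w x → u y Fin.< u x ⊎ (toℕ x < k × k ≤ toℕ y)

private
  -- A new inversion other than `(a , b)` pairs `a` or `b` with a position `c` whose value lies
  -- between `v a` and `v b`. The cover condition keeps `c` from standing between `a` and `b`, so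
  -- `c` lies beyond the other endpoint and the pair straddles `k`.
  cover-InvBound : ∀ {m k} (v : Perm (suc m)) (a b : Fin (suc m)) → Inj v → toℕ a < k → k ≤ toℕ b →
                   ℓ (v ∘ transpose a b) ≡ suc (ℓ v) → InvBound k v (v ∘ transpose a b)
  cover-InvBound {k = k} v a b v-inj a<k k≤b eq {x} {y} x<y = go (transposeView a b x) (transposeView a b y)
    where
    a<b = ℕₚ.<-≤-trans a<k k≤b
    va<vb = cover⇒< v v-inj a<b eq
    nb = cover⇒nothingBetween v {a} {b} v-inj eq
    go : TransposeView a b x → TransposeView a b y → v (transpose a b y) Fin.< v (transpose a b x) →
         v y Fin.< v x ⊎ (toℕ x < k × k ≤ toℕ y)
    go (isLeft refl) (isLeft refl) lt = contradiction x<y (ℕₚ.<-irrefl refl)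
    go (isLeft refl) (isRight refl) lt = inj₂ (a<k , k≤b)
    go (isLeft refl) (isOther y≢a y≢b) lt rewrite transpose-left x b | transpose-other x b y≢a y≢b with k ℕ.≤? toℕ y
    ... | yes k≤y = inj₂ (a<k , k≤y)
    ... | no k≰y with compare-at v-inj y≢a
    ...   | inj₁ vy<va = inj₁ vy<va
    ...   | inj₂ va<vy = contradiction lt (nb x<y (ℕₚ.<-≤-trans (ℕₚ.≰⇒> k≰y) k≤b) va<vy)
    go (isRight refl) (isLeft refl) lt = contradiction x<y (ℕₚ.<-asym a<b)
    go (isRight refl) (isRight refl) lt = contradiction x<y (ℕₚ.<-irrefl refl)
    go (isRight refl) (isOther y≢a y≢b) lt rewrite transpose-right a x | transpose-other a x y≢a y≢b =
      inj₁ (ℕₚ.<-trans lt va<vb)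
    go (isOther x≢a x≢b) (isLeft refl) lt rewrite transpose-left y b | transpose-other y b x≢a x≢b =
      inj₁ (ℕₚ.<-trans va<vb lt)
    go (isOther x≢a x≢b) (isRight refl) lt rewrite transpose-right a y | transpose-other a y x≢a x≢b with k ℕ.≤? toℕ x
    ... | no k≰x = inj₂ (ℕₚ.≰⇒> k≰x , k≤b)
    ... | yes k≤x with compare-at v-inj x≢b
    ...   | inj₁ vx<vb = contradiction vx<vb (nb (ℕₚ.<-≤-trans a<k k≤x) x<y lt)
    ...   | inj₂ vb<vx = inj₁ vb<vx
    go (isOther x≢a x≢b) (isOther y≢a y≢b) lt rewrite transpose-other a b x≢a x≢b | transpose-other a b y≢a y≢b = inj₁ lt

factor-injective : ∀ {n} {v w : Perm n} (a b : Fin n) → Inj w → (∀ x → w x ≡ v (transpose a b x)) → Inj v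
factor-injective {v = v} {w} a b w-inj eq {x} {y} vx≡vy =
  transpose-injective a b (w-inj (trans (w∘ x) (trans vx≡vy (sym (w∘ y)))))
  where
  w∘ : ∀ x → w (transpose a b x) ≡ v x
  w∘ x = trans (eq _) (cong v (transpose-involutive a b x))

≤k⇒InvBound : ∀ {m k} {u w : Perm (suc m)} → Inj w → u ≤[ k ] w → InvBound k u w
≤k⇒InvBound w-inj (≤k-refl eq) x<y lt = inj₁ (subst₂ Fin._<_ (sym (eq _)) (sym (eq _)) lt)
≤k⇒InvBound {w = w} w-inj (≤k-step {v} a b u≤v a<k k≤b cov eq) x<y lt =
  [ ≤k⇒InvBound v-inj u≤v x<y , inj₂ ]′
    (cover-InvBound v a b v-inj a<k k≤b cov x<y (subst₂ Fin._<_ (eq _) (eq _) lt))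
  where v-inj = factor-injective {v = v} a b w-inj eq

-- Sufficiency of the Bergeron-Sottile criterion

search-first : ∀ {n} {P : Fin n → Set} → (∀ x → Dec (P x)) →
               (∀ x → P x) ⊎ ∃ λ x → ¬ P x × (∀ {y} → y Fin.< x → P y)
search-first {zero}  P? = inj₁ λ ()
search-first {suc n} P? with P? zero
... | no ¬p = inj₂ (zero , ¬p , λ ())
... | yes p with search-first (P? ∘ suc)
...   | inj₁ all = inj₁ λ { zero → p ; (suc x) → all x }
...   | inj₂ (x , ¬px , below) = inj₂ (suc x , ¬px , λ { {zero} _ → p ; {suc y} (s≤s lt) → below lt })

search-last : ∀ {n} {P : Fin n → Set} → (∀ x → Dec (P x)) →
              (∀ x → ¬ P x) ⊎ ∃ λ x → P x × (∀ {y} → x Fin.< y → ¬ P y)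
search-last {zero}  P? = inj₁ λ ()
search-last {suc n} P? with search-last (P? ∘ suc)
... | inj₂ (x , px , above) = inj₂ (suc x , px , λ { {suc y} (s≤s lt) → above lt })
... | inj₁ none with P? zero
...   | yes p = inj₂ (zero , p , λ { {suc y} _ → none y })
...   | no ¬p = inj₁ λ { zero → ¬p ; (suc x) → none x }

injective⇒surjective : ∀ {n} {v : Perm n} → Inj v → ∀ c → ∃ λ x → v x ≡ c
injective⇒surjective {suc n} {v} v-inj c with Finₚ.any? (λ x → v x Fin.≟ c)
... | yes found = found
... | no ¬found = contradiction
  (Finₚ.injective⇒≤ {f = λ x → Fin.punchOut (c≢v x)} (λ {x} {y} → v-inj ∘ Finₚ.punchOut-injective (c≢v x) (c≢v y)))
  ℕₚ.1+n≰n
  where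
  c≢v : ∀ x → c ≢ v x
  c≢v x eq = ¬found (x , sym eq)

nonincreasing⇒id : ∀ {n} {ζ : Perm n} → Inj ζ → (∀ γ → ¬ γ Fin.< ζ γ) → ∀ γ → ζ γ ≡ γ
nonincreasing⇒id {ζ = ζ} ζ-inj ζ≤ with search-first (λ γ → ζ γ Fin.≟ γ)
... | inj₁ all = all
... | inj₂ (γ , ζγ≢γ , below) =
  contradiction (ζ-inj (below ([ id , ⊥-elim ∘ ζ≤ γ ]′ (≢⇒<⊎> ζγ≢γ)))) ζγ≢γ

-- `β` is the first point above `α` that `ζ` moves; it exists because `ζ α` cannot be fixed as well.
-- `ζ` moves `β` down, as no ascent lies above `α`, and not into the gap between `α` and `β`, whose
-- points are already images of themselves.
first-drop : ∀ {n} {ζ : Perm n} → Inj ζ → ∀ {α} → α Fin.< ζ α → (∀ {γ} → α Fin.< γ → ¬ γ Fin.< ζ γ) →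
             ∃ λ β → α Fin.< β × ζ β Fin.≤ α × (∀ {γ} → α Fin.< γ → γ Fin.< β → ζ γ ≡ γ)
first-drop {ζ = ζ} ζ-inj {α} α<ζα last with search-first (λ γ → (α Fin.<? γ) →-dec (ζ γ Fin.≟ γ))
... | inj₁ all = contradiction (sym (ζ-inj (all (ζ α) α<ζα))) (<⇒≢ α<ζα)
... | inj₂ (β , ¬fixed , below) with α Fin.<? β
...   | no α≮β = contradiction (λ α<β → contradiction α<β α≮β) ¬fixed
...   | yes α<β = β , α<β , ℕₚ.≮⇒≥ ζβ≯α , λ α<γ γ<β → below γ<β α<γ
  where
  ζβ≢β : ζ β ≢ β
  ζβ≢β eq = ¬fixed λ _ → eq
  ζβ<β : ζ β Fin.< β
  ζβ<β = [ id , ⊥-elim ∘ last α<β ]′ (≢⇒<⊎> ζβ≢β)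
  ζβ≯α : ¬ α Fin.< ζ β
  ζβ≯α α<ζβ = ζβ≢β (ζ-inj (below ζβ<β α<ζβ))

-- `≤k-step` adds covers at the top of a chain, whereas the exchange argument finds them at the
-- bottom.
≤k-prepend : ∀ {n k} {u w : Perm n} (a b : Fin n) → toℕ a < k → k ≤ toℕ b → ℓ (u ∘ transpose a b) ≡ suc (ℓ u) →
             (u ∘ transpose a b) ≤[ k ] w → u ≤[ k ] w
≤k-prepend a b a<k k≤b cov (≤k-refl eq) = ≤k-step a b (≤k-refl λ _ → refl) a<k k≤b cov (sym ∘ eq)
≤k-prepend a b a<k k≤b cov (≤k-step a′ b′ le a′<k k≤b′ cov′ eq) =
  ≤k-step a′ b′ (≤k-prepend a b a<k k≤b cov le) a′<k k≤b′ cov′ eq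

record Criterion {n} (k : ℕ) (u w : Perm n) : Set where
  field
    raised   : ∀ {x} → toℕ x < k → u x Fin.≤ w x
    lowered  : ∀ {x} → k ≤ toℕ x → w x Fin.≤ u x
    invBound : InvBound k u w

-- In terms of ζ = w u⁻¹, the value `u a` is carried up to at least `u b`, the value `u b` down to
-- at most `u a`, and all values between them are fixed. By `raised` and `lowered`, `a` and `b` then
-- lie on opposite sides of `k`.
module ExchangeStep {m k} {u w : Perm (suc m)} (u-inj : Inj u) (crit : Criterion k u w) {a b : Fin (suc m)}
    (ua<ub : u a Fin.< u b) (ub≤wa : u b Fin.≤ w a) (wb≤ua : w b Fin.≤ u a)
    (fixed : ∀ x → u a Fin.< u x → u x Fin.< u b → w x ≡ u x) where
  open Criterion crit

  a<k : toℕ a < k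
  a<k = ℕₚ.≰⇒> λ k≤a → ℕₚ.<⇒≱ (ℕₚ.<-≤-trans ua<ub ub≤wa) (lowered k≤a)

  k≤b : k ≤ toℕ b
  k≤b = ℕₚ.≮⇒≥ λ b<k → ℕₚ.<⇒≱ (ℕₚ.≤-<-trans wb≤ua ua<ub) (raised b<k)

  a<b : a Fin.< b
  a<b = ℕₚ.<-≤-trans a<k k≤b

  -- An intermediate `c` has `w c ≡ u c`, so both `(a , c)` and `(c , b)` are inversions of `w` and
  -- not of `u`. One of these pairs lies on a single side of `k`, against `invBound`.
  nothingBetween : NothingBetween u a b
  nothingBetween {c} a<c c<b ua<uc uc<ub with toℕ c ℕ.<? k
  ... | yes c<k with invBound a<c (subst (Fin._< w a) (sym (fixed c ua<uc uc<ub)) (ℕₚ.<-≤-trans uc<ub ub≤wa))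
  ...   | inj₁ uc<ua = ℕₚ.<-asym ua<uc uc<ua
  ...   | inj₂ (_ , k≤c) = ℕₚ.<⇒≱ c<k k≤c
  nothingBetween {c} a<c c<b ua<uc uc<ub | no c≮k
    with invBound c<b (subst (w b Fin.<_) (sym (fixed c ua<uc uc<ub)) (ℕₚ.≤-<-trans wb≤ua ua<uc))
  ...   | inj₁ ub<uc = ℕₚ.<-asym uc<ub ub<uc
  ...   | inj₂ (c<k , _) = c≮k c<k

  raised′ : ∀ {x} → toℕ x < k → u (transpose a b x) Fin.≤ w x
  raised′ {x} x<k with transposeView a b x
  ... | isLeft refl rewrite transpose-left a b = ub≤wa
  ... | isRight refl = contradiction x<k (ℕₚ.≤⇒≯ k≤b)
  ... | isOther p q rewrite transpose-other a b p q = raised x<k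

  lowered′ : ∀ {x} → k ≤ toℕ x → w x Fin.≤ u (transpose a b x)
  lowered′ {x} k≤x with transposeView a b x
  ... | isLeft refl = contradiction a<k (ℕₚ.≤⇒≯ k≤x)
  ... | isRight refl rewrite transpose-right a b = wb≤ua
  ... | isOther p q rewrite transpose-other a b p q = lowered k≤x

  invBound′ : InvBound k (u ∘ transpose a b) w
  invBound′ {x} {y} x<y wy<wx with invBound x<y wy<wx
  ... | inj₂ straddle = inj₂ straddle
  ... | inj₁ uy<ux = go (transposeView a b x) (transposeView a b y)
    where
    go : TransposeView a b x → TransposeView a b y →
         u (transpose a b y) Fin.< u (transpose a b x) ⊎ (toℕ x < k × k ≤ toℕ y)
    go (isLeft refl) (isLeft refl) = contradiction x<y (ℕₚ.<-irrefl refl)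
    go (isLeft refl) (isRight refl) = inj₂ (a<k , k≤b)
    go (isLeft refl) (isOther p q) rewrite transpose-left x b | transpose-other x b p q = inj₁ (ℕₚ.<-trans uy<ux ua<ub)
    go (isRight refl) (isLeft refl) = contradiction x<y (ℕₚ.<-asym a<b)
    go (isRight refl) (isRight refl) = contradiction x<y (ℕₚ.<-irrefl refl)
    -- An inversion of `u` that the exchange could destroy has its other value strictly between
    -- `u a` and `u b`. There `w` agrees with `u`, so the pair is not an inversion of `w` either.
    go (isRight refl) (isOther p q) rewrite transpose-right a x | transpose-other a x p q with compare-at u-inj p
    ... | inj₁ uy<ua = inj₁ uy<ua
    ... | inj₂ ua<uy = contradiction (subst (Fin._< w x) (fixed y ua<uy uy<ux) wy<wx)
                                     (ℕₚ.<-asym (ℕₚ.≤-<-trans wb≤ua ua<uy))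
    go (isOther p q) (isLeft refl) rewrite transpose-left y b | transpose-other y b p q with compare-at u-inj q
    ... | inj₂ ub<ux = inj₁ ub<ux
    ... | inj₁ ux<ub = contradiction (subst (w y Fin.<_) (fixed x uy<ux ux<ub) wy<wx)
                                     (ℕₚ.<-asym (ℕₚ.<-≤-trans ux<ub ub≤wa))
    go (isOther p q) (isRight refl) rewrite transpose-right a y | transpose-other a y p q = inj₁ (ℕₚ.<-trans ua<ub uy<ux)
    go (isOther p q) (isOther p′ q′) rewrite transpose-other a b p q | transpose-other a b p′ q′ = inj₁ uy<ux

CoverBelow : ∀ {n} → ℕ → Perm n → Perm n → Set
CoverBelow k u w = ∃ λ a → ∃ λ b →
  toℕ a < k × k ≤ toℕ b × ℓ (u ∘ transpose a b) ≡ suc (ℓ u) × Criterion k (u ∘ transpose a b) w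

-- Bergeron–Sottile: ζ = w u⁻¹ maps the value at each position of u to that of w.  With α the last ascent of ζ
-- and β as in first-drop, exchanging the values α and β is a k-Bruhat cover of u that stays below w.
criterion-step : ∀ {m k} {u w : Perm (suc m)} → Inj u → Inj w → Criterion k u w → (∀ x → u x ≡ w x) ⊎ CoverBelow k u w
criterion-step {m} {k} {u} {w} u-inj w-inj crit =
  step (proj₁ ∘ injective⇒surjective u-inj) (proj₂ ∘ injective⇒surjective u-inj)
  where
  step : (u⁻¹ : Perm (suc m)) → (∀ γ → u (u⁻¹ γ) ≡ γ) → (∀ x → u x ≡ w x) ⊎ CoverBelow k u w
  step u⁻¹ uu⁻¹ with search-last (λ γ → γ Fin.<? w (u⁻¹ γ))
  ... | inj₁ none = inj₁ λ x → sym (trans (cong w (sym (u-inj (uu⁻¹ (u x))))) (nonincreasing⇒id ζ-inj none (u x)))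
    where
    ζ-inj : Inj (w ∘ u⁻¹)
    ζ-inj {x} {y} eq = trans (sym (uu⁻¹ x)) (trans (cong u (w-inj eq)) (uu⁻¹ y))
  ... | inj₂ (α , α<ζα , last) = inj₂ exchange-values
    where
    ζ-inj : Inj (w ∘ u⁻¹)
    ζ-inj {x} {y} eq = trans (sym (uu⁻¹ x)) (trans (cong u (w-inj eq)) (uu⁻¹ y))
    exchange-values : CoverBelow k u w
    exchange-values with first-drop ζ-inj α<ζα last
    ... | β , α<β , ζβ≤α , ζ-fixed =
      u⁻¹ α , u⁻¹ β , a<k , k≤b , ℓ-cover u u-inj a<b ua<ub nothingBetween ,
      record { raised = raised′ ; lowered = lowered′ ; invBound = invBound′ }
      where
      ua<ub : u (u⁻¹ α) Fin.< u (u⁻¹ β)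
      ua<ub = subst₂ Fin._<_ (sym (uu⁻¹ α)) (sym (uu⁻¹ β)) α<β
      β≤ζα : β Fin.≤ w (u⁻¹ α)
      β≤ζα = ℕₚ.≮⇒≥ λ ζα<β → <⇒≢ α<ζα (sym (ζ-inj (ζ-fixed α<ζα ζα<β)))
      open ExchangeStep u-inj crit ua<ub
        (subst (Fin._≤ w (u⁻¹ α)) (sym (uu⁻¹ β)) β≤ζα)
        (subst (w (u⁻¹ β) Fin.≤_) (sym (uu⁻¹ α)) ζβ≤α)
        (λ x ua<ux ux<ub → trans (cong w (sym (u-inj (uu⁻¹ (u x)))))
          (ζ-fixed (subst (Fin._< u x) (uu⁻¹ α) ua<ux) (subst (u x Fin.<_) (uu⁻¹ β) ux<ub)))

-- Each cover raises `ℓ u` by one, and a length never exceeds the square of the number of positions;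
-- the fuel measures the remaining room.
criterion⇒≤k : ∀ {m k} {u w : Perm (suc m)} → Inj u → Inj w → Criterion k u w → u ≤[ k ] w
criterion⇒≤k {m} {k} {w = w} u-inj w-inj crit = go (suc m * suc m) u-inj (ℕₚ.m≤m+n _ _) crit
  where
  go : ∀ fuel {u : Perm (suc m)} → Inj u → suc m * suc m ≤ fuel + ℓ u → Criterion k u w → u ≤[ k ] w
  go fuel {u} u-inj enough crit with criterion-step u-inj w-inj crit
  ... | inj₁ eq = ≤k-refl eq
  go zero {u} u-inj enough crit | inj₂ (a , b , _ , _ , cov , _) =
    contradiction (ℕₚ.≤-trans (subst (_≤ suc m * suc m) cov (inversions≤n² (u ∘ transpose a b))) enough) ℕₚ.1+n≰n
  go (suc fuel) {u} u-inj enough crit | inj₂ (a , b , a<k , k≤b , cov , crit′) =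
    ≤k-prepend a b a<k k≤b cov (go fuel (∘-transpose-injective a b u-inj)
      (subst (suc m * suc m ≤_) (trans (sym (ℕₚ.+-suc fuel (ℓ u))) (cong (fuel +_) (sym cov))) enough) crit′)

-- Comparison of counts by matchings

count-remove : ∀ {n} (q : Fin n → Bool) {y₀} → q y₀ ≡ true → countFin q ≡ suc (countFin λ y → q y ∧ not (does (y Fin.≟ y₀)))
count-remove q {zero} q₀ rewrite q₀ = cong suc (countFin-cong λ y → sym (Boolₚ.∧-identityʳ (q (suc y))))
count-remove q {suc y₀} qy rewrite Boolₚ.∧-identityʳ (q zero) =
  trans (cong ((if q zero then 1 else 0) +_) (count-remove (q ∘ suc) qy)) (ℕₚ.+-suc _ _)

-- The matching is a relation instead of a function, since a partner is available only for a counted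
-- `x`. The induction removes the partner of the first counted element from `q`.
count-≤ : ∀ {n n′} (p : Fin n → Bool) (q : Fin n′ → Bool) {R : Fin n → Fin n′ → Set} →
          (∀ x → p x ≡ true → ∃ λ y → q y ≡ true × R x y) → (∀ {x x′ y} → R x y → R x′ y → x ≡ x′) →
          countFin p ≤ countFin q
count-≤ {zero}  p q match unique = z≤n
count-≤ {suc n} p q {R} match unique with p zero in p₀
... | false = count-≤ (p ∘ suc) q (match ∘ suc) (λ r r′ → Finₚ.suc-injective (unique r r′))
... | true with match zero p₀
...   | y₀ , qy₀ , r₀ = ℕₚ.≤-trans
  (s≤s (count-≤ (p ∘ suc) q′ {R ∘ suc} match′ (λ r r′ → Finₚ.suc-injective (unique r r′))))
  (ℕₚ.≤-reflexive (sym (count-remove q qy₀)))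
  where
  q′ : Fin _ → Bool
  q′ y = q y ∧ not (does (y Fin.≟ y₀))
  match′ : ∀ x → p (suc x) ≡ true → ∃ λ y → q′ y ≡ true × R (suc x) y
  match′ x px with match (suc x) px
  ... | y , qy , r = y , cong₂ _∧_ qy (cong not (dec-false (y Fin.≟ y₀) λ { refl → contradiction (unique r₀ r) λ () })) , r

∧-true : ∀ {a b} → a ∧ b ≡ true → a ≡ true × b ≡ true
∧-true {true} {true} refl = refl , refl

does-true : ∀ {P : Set} (P? : Dec P) → does P? ≡ true → P
does-true (yes p) _ = p

-- Bridges

Bridges : ℕ → Set
Bridges n = List (Fin n × Fin n)

-- The first letter is the rightmost factor of the Marsh-Rietsch product, so its bridge is added
-- last; hence `∷ʳ`.
bridgesOf : ∀ {m} → Perm (suc m) → Expr m → Bridges (suc m)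
bridgesOf v []                = []
bridgesOf v ((i , true)  ∷ e) = bridgesOf (v ∘ s i) e
bridgesOf v ((i , false) ∷ e) = bridgesOf v e ∷ʳ (v (inject₁ i) , v (suc i))

after : ∀ {n} → (Fin n → ℕ) → Bridges n → Fin n → ℕ
after f []             = f
after f ((a , b) ∷ bs) = after (f ∘ transpose a b) bs

after-∷ʳ : ∀ {n} (f : Fin n → ℕ) (bs : Bridges n) {a b} → after f (bs ∷ʳ (a , b)) ≡ after f bs ∘ transpose a b
after-∷ʳ f []       = refl
after-∷ʳ f (_ ∷ bs) = after-∷ʳ _ bs

Fixed Shifted : ∀ {n} → (Fin n → ℕ) → Fin n → Set
Fixed f c = f c ≡ toℕ c
Shifted {n} f c = f c ≡ toℕ c + n

record ValidBridge {n} (f : Fin n → ℕ) (a b : Fin n) : Set where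
  constructor validBridge
  field
    a<b       : a Fin.< b
    fb<fa     : f b < f a
    lollipops : ∀ c → a Fin.< c → c Fin.< b → Fixed f c ⊎ Shifted f c

valid-∷ʳ : ∀ {n} {f : Fin n → ℕ} (bs : Bridges n) {a b} → ValidBridges f bs → ValidBridge (after f bs) a b →
           ValidBridges f (bs ∷ʳ (a , b))
valid-∷ʳ []       _ (validBridge a<b lt between) = a<b , lt , between , _
valid-∷ʳ (_ ∷ bs) (a<b , lt , between , valid) step = a<b , lt , between , valid-∷ʳ bs valid step

valid-∷ʳ⁻ : ∀ {n} {f : Fin n → ℕ} (bs : Bridges n) {a b} → ValidBridges f (bs ∷ʳ (a , b)) →
            ValidBridges f bs × ValidBridge (after f bs) a b
valid-∷ʳ⁻ []       (a<b , lt , between , _) = _ , validBridge a<b lt between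
valid-∷ʳ⁻ (_ ∷ bs) (a<b , lt , between , valid) with valid-∷ʳ⁻ bs valid
... | valid′ , step = (a<b , lt , between , valid′) , step

record Bounded {n} (f : Fin n → ℕ) : Set where
  field
    lower≤ : ∀ c → toℕ c ≤ f c
    ≤upper : ∀ c → f c ≤ toℕ c + n

-- Everything follows from the chain a < b ≤ f b < f a ≤ a + n < b + n. After the exchange the
-- labels of `a` and `b` are strictly within their bounds, so neither is a lollipop, and every
-- lollipop of `f′` is already one of `f`.
module BridgeStep {n} {f : Fin n → ℕ} (bounded : Bounded f) {a b : Fin n} (a<b : a Fin.< b) (fb<fa : f b < f a) where
  open Bounded bounded

  ¬fixed-a : ¬ Fixed f a
  ¬fixed-a eq = ℕₚ.<-irrefl refl (ℕₚ.<-trans a<b (ℕₚ.≤-<-trans (lower≤ b) (subst (f b <_) eq fb<fa)))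

  ¬shifted-b : ¬ Shifted f b
  ¬shifted-b eq = ℕₚ.<-irrefl refl
    (ℕₚ.<-≤-trans (subst (_< f a) eq fb<fa) (ℕₚ.≤-trans (≤upper a) (ℕₚ.+-monoˡ-≤ n (ℕₚ.<⇒≤ a<b))))

  f′ : Fin n → ℕ
  f′ = f ∘ transpose a b

  f′-other : ∀ {c} → c ≢ a → c ≢ b → f′ c ≡ f c
  f′-other p q = cong f (transpose-other a b p q)

  bounded-a : toℕ a < f b × f b < toℕ a + n
  bounded-a = ℕₚ.<-≤-trans a<b (lower≤ b) , ℕₚ.<-≤-trans fb<fa (≤upper a)

  bounded-b : toℕ b < f a × f a < toℕ b + n
  bounded-b = ℕₚ.≤-<-trans (lower≤ b) fb<fa , ℕₚ.≤-<-trans (≤upper a) (ℕₚ.+-monoˡ-< n a<b)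

  bounded′ : Bounded f′
  bounded′ = record { lower≤ = lo ; ≤upper = hi }
    where
    lo : ∀ c → toℕ c ≤ f′ c
    lo c with transposeView a b c
    ... | isLeft refl rewrite transpose-left a b = ℕₚ.<⇒≤ (proj₁ bounded-a)
    ... | isRight refl rewrite transpose-right a b = ℕₚ.<⇒≤ (proj₁ bounded-b)
    ... | isOther p q rewrite transpose-other a b p q = lower≤ c
    hi : ∀ c → f′ c ≤ toℕ c + n
    hi c with transposeView a b c
    ... | isLeft refl rewrite transpose-left a b = ℕₚ.<⇒≤ (proj₂ bounded-a)
    ... | isRight refl rewrite transpose-right a b = ℕₚ.<⇒≤ (proj₂ bounded-b)
    ... | isOther p q rewrite transpose-other a b p q = ≤upper c

  fixed′⁻ : ∀ {c} → Fixed f′ c → c ≢ a × c ≢ b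
  fixed′⁻ eq = (λ { refl → ℕₚ.<-irrefl (sym (trans (sym (cong f (transpose-left a b))) eq)) (proj₁ bounded-a) })
             , (λ { refl → ℕₚ.<-irrefl (sym (trans (sym (cong f (transpose-right a b))) eq)) (proj₁ bounded-b) })

  shifted′⁻ : ∀ {c} → Shifted f′ c → c ≢ a × c ≢ b
  shifted′⁻ eq = (λ { refl → ℕₚ.<-irrefl (trans (sym (cong f (transpose-left a b))) eq) (proj₂ bounded-a) })
               , (λ { refl → ℕₚ.<-irrefl (trans (sym (cong f (transpose-right a b))) eq) (proj₂ bounded-b) })

  fixed′⇒fixed : ∀ {c} → Fixed f′ c → Fixed f c
  fixed′⇒fixed eq = trans (sym (f′-other (proj₁ (fixed′⁻ eq)) (proj₂ (fixed′⁻ eq)))) eq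

  shifted′⇒shifted : ∀ {c} → Shifted f′ c → Shifted f c
  shifted′⇒shifted eq = trans (sym (f′-other (proj₁ (shifted′⁻ eq)) (proj₂ (shifted′⁻ eq)))) eq

-- The invariants carried along the word

Compatible : ∀ {n} → Perm n → (Fin n → ℕ) → Set
Compatible v f = ∀ {x y} → x Fin.< y → v y Fin.< v x → Shifted f (v x) ⊎ Fixed f (v y)

-- Used with `F = f ∘ v`. At a bridge letter `w ∘ s i` descends at `i`, and the inclusion turns this
-- into `f b < f a`.
InvIncluded : ∀ {n} → Perm n → (Fin n → ℕ) → Set
InvIncluded w F = ∀ {x y} → x Fin.< y → w y Fin.< w x → F y < F x

transpose-∘ : ∀ {m} {v : Perm (suc m)} → Inj v → ∀ i x → transpose (v (inject₁ i)) (v (suc i)) (v x) ≡ v (s i x)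
transpose-∘ {v = v} v-inj i x with transposeView (inject₁ i) (suc i) x
... | isLeft refl = trans (transpose-left (v (inject₁ i)) (v (suc i))) (cong v (sym (s-left i)))
... | isRight refl = trans (transpose-right (v (inject₁ i)) (v (suc i))) (cong v (sym (s-right i)))
... | isOther p q = trans (transpose-other _ _ (p ∘ v-inj) (q ∘ v-inj)) (cong v (sym (transpose-other _ _ p q)))

InvIncluded-s⁻ : ∀ {m} {w : Perm (suc m)} {F G : Fin (suc m) → ℕ} (i : Fin m) → w (inject₁ i) Fin.< w (suc i) →
                 (∀ x → G x ≡ F (s i x)) → InvIncluded (w ∘ s i) G → InvIncluded w F
InvIncluded-s⁻ {w = w} {F} {G} i asc eq incl {x} {y} x<y lt with s-mono i x<y
... | inj₁ (refl , refl) = contradiction lt (ℕₚ.<-asym asc)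
... | inj₂ sx<sy = subst₂ _<_ (G-s y) (G-s x)
  (incl sx<sy (subst₂ (λ p q → w p Fin.< w q) (sym (s-involutive i y)) (sym (s-involutive i x)) lt))
  where
  G-s : ∀ x → G (s i x) ≡ F x
  G-s x = trans (eq _) (cong F (s-involutive i x))

module BridgeAt {m} {v : Perm (suc m)} {f : Fin (suc m) → ℕ} (v-inj : Inj v) (bounded : Bounded f) (compat : Compatible v f)
    (i : Fin m) (a<b : v (inject₁ i) Fin.< v (suc i)) (fb<fa : f (v (suc i)) < f (v (inject₁ i))) where
  open BridgeStep bounded a<b fb<fa public

  private
    <suc : ∀ {x} → x ≢ inject₁ i → x Fin.< suc i → x Fin.< inject₁ i
    <suc {x} x≢ lt = ℕₚ.≤∧≢⇒< (subst (toℕ x ≤_) (sym (Finₚ.toℕ-inject₁ i)) (ℕₚ.≤-pred lt)) (x≢ ∘ Finₚ.toℕ-injective)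

    inject₁< : ∀ {x} → x ≢ suc i → inject₁ i Fin.< x → suc i Fin.< x
    inject₁< {x} x≢ lt = ℕₚ.≤∧≢⇒< (subst (_< toℕ x) (Finₚ.toℕ-inject₁ i) lt) (x≢ ∘ sym ∘ Finₚ.toℕ-injective)

    -- `a` is not fixed and `b` is not shifted, so compatibility with either of them leaves a single
    -- alternative.
    left : ∀ {x} → x Fin.< inject₁ i → v (inject₁ i) Fin.< v x → Shifted f (v x)
    left x<i lt with compat x<i lt
    ... | inj₁ sh = sh
    ... | inj₂ fx = contradiction fx ¬fixed-a

    right : ∀ {y} → suc i Fin.< y → v y Fin.< v (suc i) → Fixed f (v y)
    right i<y lt with compat i<y lt
    ... | inj₁ sh = contradiction sh ¬shifted-b
    ... | inj₂ fx = fx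

  -- Only the labels of `a` and `b` change. An inversion involving one of them therefore has to rely
  -- on its other member, which `left` or `right` shows to be a lollipop of the required kind.
  compatible′ : Compatible v f′
  compatible′ {x} {y} x<y vy<vx with transposeView (inject₁ i) (suc i) x | transposeView (inject₁ i) (suc i) y
  ... | isLeft refl | isLeft refl = contradiction x<y (ℕₚ.<-irrefl refl)
  ... | isLeft refl | isRight refl = contradiction vy<vx (ℕₚ.<-asym a<b)
  ... | isLeft refl | isOther p q =
    inj₂ (trans (f′-other (p ∘ v-inj) (q ∘ v-inj)) (right (inject₁< q x<y) (ℕₚ.<-trans vy<vx a<b)))
  ... | isRight refl | isLeft refl = contradiction x<y (ℕₚ.<-asym (inject₁<suc i))
  ... | isRight refl | isRight refl = contradiction x<y (ℕₚ.<-irrefl refl)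
  ... | isRight refl | isOther p q =
    inj₂ (trans (f′-other (p ∘ v-inj) (q ∘ v-inj)) (right x<y vy<vx))
  ... | isOther p q | isLeft refl =
    inj₁ (trans (f′-other (p ∘ v-inj) (q ∘ v-inj)) (left x<y vy<vx))
  ... | isOther p q | isRight refl =
    inj₁ (trans (f′-other (p ∘ v-inj) (q ∘ v-inj)) (left (<suc p x<y) (ℕₚ.<-trans a<b vy<vx)))
  ... | isOther p q | isOther p′ q′ with compat x<y vy<vx
  ...   | inj₁ sh = inj₁ (trans (f′-other (p ∘ v-inj) (q ∘ v-inj)) sh)
  ...   | inj₂ fx = inj₂ (trans (f′-other (p′ ∘ v-inj) (q′ ∘ v-inj)) fx)

  between : ∀ x → v (inject₁ i) Fin.< v x → v x Fin.< v (suc i) →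
            (x Fin.< inject₁ i × Shifted f (v x)) ⊎ (suc i Fin.< x × Fixed f (v x))
  between x a<c c<b with Finₚ.<-cmp x (inject₁ i)
  ... | tri< x<i _ _ = inj₁ (x<i , left x<i a<c)
  ... | tri≈ _ refl _ = contradiction a<c (ℕₚ.<-irrefl refl)
  ... | tri> _ _ i<x = inj₂ (i+1<x , right i+1<x c<b)
    where i+1<x = inject₁< (λ { refl → ℕₚ.<-irrefl refl c<b }) i<x

  valid : ValidBridge f (v (inject₁ i)) (v (suc i))
  valid = validBridge a<b fb<fa λ c → go c (injective⇒surjective v-inj c)
    where
    go : ∀ c → (∃ λ x → v x ≡ c) → v (inject₁ i) Fin.< c → c Fin.< v (suc i) → Fixed f c ⊎ Shifted f c
    go _ (x , refl) a<c c<b with between x a<c c<b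
    ... | inj₁ (_ , sh) = inj₂ sh
    ... | inj₂ (_ , fx) = inj₁ fx

-- Reduced words as chains of ascents

Ascending : ∀ {m} → Perm (suc m) → List (Fin m) → Set
Ascending w []       = ⊤
Ascending w (i ∷ is) = w (inject₁ i) Fin.< w (suc i) × Ascending (w ∘ s i) is

∘-s-injective : ∀ {m N} {v : Fin (suc m) → Fin N} (i : Fin m) → Inj v → Inj (v ∘ s i)
∘-s-injective i = ∘-transpose-injective (inject₁ i) (suc i)

ℓ-∘-wordProd-≤ : ∀ {m} {w : Perm (suc m)} → Inj w → ∀ is → ℓ (w ∘ wordProd is) ≤ ℓ w + length is
ℓ-∘-wordProd-≤ w-inj [] = ℕₚ.m≤m+n _ _
ℓ-∘-wordProd-≤ {w = w} w-inj (i ∷ is) = ℕₚ.≤-trans (ℓ-∘-wordProd-≤ (∘-s-injective i w-inj) is)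
  (ℕₚ.≤-trans (ℕₚ.+-monoˡ-≤ (length is) (step (ℓ-s-cases w-inj i))) (ℕₚ.≤-reflexive (sym (ℕₚ.+-suc (ℓ w) (length is)))))
  where
  step : _ → ℓ (w ∘ s i) ≤ suc (ℓ w)
  step (inj₁ (_ , eq)) = ℕₚ.≤-reflexive eq
  step (inj₂ (_ , eq)) = ℕₚ.≤-trans (ℕₚ.n≤1+n _) (ℕₚ.≤-trans (ℕₚ.≤-reflexive (sym eq)) (ℕₚ.n≤1+n _))

-- Each letter changes the length by one, so reaching the full length leaves no room for a descent.
reduced⇒ascending : ∀ {m} {w : Perm (suc m)} → Inj w → ∀ is → ℓ w + length is ≤ ℓ (w ∘ wordProd is) → Ascending w is
reduced⇒ascending w-inj [] le = _
reduced⇒ascending {w = w} w-inj (i ∷ is) le with ℓ-s-cases w-inj i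
... | inj₁ (asc , eq) = asc , reduced⇒ascending (∘-s-injective i w-inj) is
  (ℕₚ.≤-trans (ℕₚ.≤-reflexive (trans (cong (_+ length is) eq) (sym (ℕₚ.+-suc (ℓ w) (length is))))) le)
... | inj₂ (_ , eq) = contradiction
  (ℕₚ.≤-trans le (ℕₚ.≤-trans (ℓ-∘-wordProd-≤ (∘-s-injective i w-inj) is) (ℕₚ.+-monoˡ-≤ (length is) (ℕₚ.≤-trans (ℕₚ.n≤1+n _) (ℕₚ.≤-reflexive (sym eq))))))
  (ℕₚ.<⇒≱ (ℕₚ.≤-reflexive (sym (ℕₚ.+-suc (ℓ w) (length is)))))

ascending⇒reduced : ∀ {m} {w : Perm (suc m)} → ∀ is → Ascending w is → ℓ (w ∘ wordProd is) ≡ ℓ w + length is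
ascending⇒reduced [] _ = sym (ℕₚ.+-identityʳ _)
ascending⇒reduced {w = w} (i ∷ is) (asc , rest) =
  trans (ascending⇒reduced is rest) (trans (cong (_+ length is) (ℓ-s-ascent w i asc)) (sym (ℕₚ.+-suc (ℓ w) (length is))))

-- Validity and signs of the bridges of a positive subexpression

leftCount : ∀ {m} → Perm (suc m) → Fin m → ℕ
leftCount v i = countFin λ q → does (q Fin.<? inject₁ i) ∧ (does (v (inject₁ i) Fin.<? v q) ∧ does (v q Fin.<? v (suc i)))

-- Equates the sign exponent that the bridge graph reads off `I` with `leftCount`, the exponent that
-- the matrix computation produces in `xs-signed`.
SignsMatch : ∀ {m k} → (Fin k → Fin (suc m)) → Perm (suc m) → Expr m → Set
SignsMatch I v []                = ⊤
SignsMatch I v ((i , true)  ∷ e) = SignsMatch I (v ∘ s i) e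
SignsMatch I v ((i , false) ∷ e) =
  countFin (λ r → does (v (inject₁ i) Fin.<? I r) ∧ does (I r Fin.<? v (suc i))) ≡ leftCount v i × SignsMatch I v e

-- Bridges destroy lollipops and create none, so the implications from the current lollipops to
-- membership in `I` survive every step, while their converses fail at the ends of a bridge.
record State {m k} (I : Fin k → Fin (suc m)) (v w : Perm (suc m)) (f : Fin (suc m) → ℕ) : Set where
  field
    bounded     : Bounded f
    compatible  : Compatible v f
    included    : InvIncluded w (f ∘ v)
    shifted⇒∈   : ∀ {c} → Shifted f c → ∃ λ r → I r ≡ c
    fixed⇒∉     : ∀ {c} → Fixed f c → ∀ r → I r ≢ c

module _ {m k} {I : Fin k → Fin (suc m)} (I-inj : Inj I) where

  -- The state is given at the end of the word, where the graph consists of lollipops, and is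
  -- carried back to the front, because bridges are added from the last letter to the first.
  deodhar⇒valid : ∀ (e : Expr m) {v w} {f₀ : Fin (suc m) → ℕ} → Inj v → PositiveFrom v e → Ascending w (word e) →
    State I (subProdFrom v e) (w ∘ wordProd (word e)) f₀ →
    State I v w (after f₀ (bridgesOf v e)) × ValidBridges f₀ (bridgesOf v e) × SignsMatch I v e
  deodhar⇒valid [] v-inj _ _ st = st , _ , _
  deodhar⇒valid ((i , true) ∷ e) {v} {w} {f₀} v-inj (up , pos) (asc , ascs) st
    with deodhar⇒valid e (∘-s-injective i v-inj) pos ascs st
  ... | st′ , val , sgn = record
      { bounded = bounded ; compatible = compat ; included = InvIncluded-s⁻ i asc (λ _ → refl) included
      ; shifted⇒∈ = shifted⇒∈ ; fixed⇒∉ = fixed⇒∉ } , val , sgn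
    where
    open State st′
    f = after f₀ (bridgesOf (v ∘ s i) e)
    compat : Compatible v f
    compat {x} {y} x<y lt with s-mono i x<y
    -- Positivity makes `i` an ascent of `v`, so the one pair whose order `s i` reverses is not an
    -- inversion of `v`.
    ... | inj₁ (refl , refl) = contradiction lt (ℕₚ.<-asym (ℓ<⇒ascent v-inj i up))
    ... | inj₂ sx<sy = subst₂ (λ p q → Shifted f (v p) ⊎ Fixed f (v q)) (s-involutive i x) (s-involutive i y)
      (compatible sx<sy (subst₂ (λ p q → v p Fin.< v q) (sym (s-involutive i y)) (sym (s-involutive i x)) lt))
  deodhar⇒valid ((i , false) ∷ e) {v} {w} {f₀} v-inj (up , pos) (asc , ascs) st
    with deodhar⇒valid e v-inj pos ascs st
  ... | st′ , val , sgn rewrite after-∷ʳ f₀ (bridgesOf v e) {v (inject₁ i)} {v (suc i)} = record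
      { bounded = bounded′ ; compatible = compatible′
      -- Here `v` stays and `f` is exchanged at `a` and `b`; by `transpose-∘` the labels `f ∘ v` are
      -- again permuted by `s i`, in step with `w`.
      ; included = InvIncluded-s⁻ i asc (λ x → cong f (sym (trans (transpose-∘ v-inj i (s i x)) (cong v (s-involutive i x))))) included
      ; shifted⇒∈ = shifted⇒∈ ∘ shifted′⇒shifted ; fixed⇒∉ = fixed⇒∉ ∘ fixed′⇒fixed }
    , valid-∷ʳ (bridgesOf v e) val valid , counts , sgn
    where
    open State st′
    f = after f₀ (bridgesOf v e)
    open BridgeAt v-inj bounded compatible i (ℓ<⇒ascent v-inj i up)
      (included (inject₁<suc i) (subst₂ (λ p q → w p Fin.< w q) (sym (s-right i)) (sym (s-left i)) asc))
    counts : countFin (λ r → does (v (inject₁ i) Fin.<? I r) ∧ does (I r Fin.<? v (suc i))) ≡ leftCount v i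
    -- By `between`, an element strictly between `a` and `b` belongs to `I` exactly if it stands
    -- before `a`; the matching pairs it with its position in `v`.
    counts = ℕₚ.≤-antisym
      (count-≤ _ _ {λ r x → v x ≡ I r} there λ p q → I-inj (trans (sym p) q))
      (count-≤ _ _ {λ x r → v x ≡ I r} back λ p q → v-inj (trans p (sym q)))
      where
      there : ∀ r → does (v (inject₁ i) Fin.<? I r) ∧ does (I r Fin.<? v (suc i)) ≡ true →
              ∃ λ x → does (x Fin.<? inject₁ i) ∧ (does (v (inject₁ i) Fin.<? v x) ∧ does (v x Fin.<? v (suc i))) ≡ true × v x ≡ I r
      there r eq with ∧-true eq | injective⇒surjective v-inj (I r)
      ... | eq₁ , eq₂ | x , vx≡ with between x
              (subst (v (inject₁ i) Fin.<_) (sym vx≡) (does-true (_ Fin.<? _) eq₁))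
              (subst (Fin._< v (suc i)) (sym vx≡) (does-true (_ Fin.<? _) eq₂))
      ...   | inj₂ (_ , fx) = contradiction (sym vx≡) (fixed⇒∉ fx r)
      ...   | inj₁ (x<i , _) = x , cong₂ _∧_ (<?-true x<i) (subst (λ c → does (v (inject₁ i) Fin.<? c) ∧ does (c Fin.<? v (suc i)) ≡ true) (sym vx≡) eq) , vx≡
      back : ∀ x → does (x Fin.<? inject₁ i) ∧ (does (v (inject₁ i) Fin.<? v x) ∧ does (v x Fin.<? v (suc i))) ≡ true →
             ∃ λ r → does (v (inject₁ i) Fin.<? I r) ∧ does (I r Fin.<? v (suc i)) ≡ true × v x ≡ I r
      back x eq with ∧-true eq
      ... | eq₀ , eq′ with ∧-true eq′
      ...   | eq₁ , eq₂ with between x (does-true (_ Fin.<? _) eq₁) (does-true (_ Fin.<? _) eq₂)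
      ...     | inj₂ (i<x , _) = contradiction (does-true (x Fin.<? inject₁ i) eq₀) (ℕₚ.<-asym (ℕₚ.<-trans (inject₁<suc i) i<x))
      ...     | inj₁ (_ , sh) with shifted⇒∈ sh
      ...       | r , Ir≡ = r , subst (λ c → does (v (inject₁ i) Fin.<? c) ∧ does (c Fin.<? v (suc i)) ≡ true) (sym Ir≡) eq′ , sym Ir≡

-- Row signs of signed permutation matrices

odd : ℕ → Bool
odd zero    = false
odd (suc n) = not (odd n)

count-+ : ∀ {n} (p q r : Fin n → Bool) →
          (∀ x → (if p x then 1 else 0) ≡ (if q x then 1 else 0) + (if r x then 1 else 0)) →
          countFin p ≡ countFin q + countFin r
count-+ {zero}  p q r eq = refl
count-+ {suc n} p q r eq = trans (cong₂ _+_ (eq zero) (count-+ (p ∘ suc) (q ∘ suc) (r ∘ suc) (eq ∘ suc)))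
  (interchange (if q zero then 1 else 0) (if r zero then 1 else 0) _ _)

count-false : ∀ {n} (p : Fin n → Bool) → (∀ x → p x ≡ false) → countFin p ≡ 0
count-false {zero}  p eq = refl
count-false {suc n} p eq rewrite eq zero = count-false (p ∘ suc) (eq ∘ suc)

-- Its parity is the sign of row `p` in `signed v`.
largerBefore : ∀ {n} → Perm n → Fin n → ℕ
largerBefore v p = countFin λ q → does (q Fin.<? p) ∧ does (v p Fin.<? v q)

module _ {m} {v : Perm (suc m)} (v-inj : Inj v) (i : Fin m) (asc : v (inject₁ i) Fin.< v (suc i)) where
  private
    a b : Fin (suc m)
    a = inject₁ i
    b = suc i
    a<⇒b≤ : ∀ {q : Fin (suc m)} → a Fin.< q → b Fin.≤ q
    a<⇒b≤ {q} = subst (_< toℕ q) (Finₚ.toℕ-inject₁ i)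

  -- Among the values before `a` that exceed `v a`, those above `v b` form the count at `b`, to
  -- which `a` itself does not contribute; the others form `leftCount v i`.
  largerBefore-ascent : largerBefore v a ≡ largerBefore v b + leftCount v i
  largerBefore-ascent = count-+ _ _ (λ q → does (q Fin.<? a) ∧ (does (v a Fin.<? v q) ∧ does (v q Fin.<? v b))) pointwise
    where
    pointwise : ∀ q → (if does (q Fin.<? a) ∧ does (v a Fin.<? v q) then 1 else 0) ≡
                (if does (q Fin.<? b) ∧ does (v b Fin.<? v q) then 1 else 0) +
                (if does (q Fin.<? a) ∧ (does (v a Fin.<? v q) ∧ does (v q Fin.<? v b)) then 1 else 0)
    pointwise q with Finₚ.<-cmp q a
    ... | tri> q≮a q≢a a<q rewrite <?-false q≮a | <?-false {x = q} {y = b} (ℕₚ.≤⇒≯ (a<⇒b≤ a<q)) = refl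
    ... | tri≈ q≮a refl _ rewrite <?-false q≮a | <?-true (inject₁<suc i) | <?-false (ℕₚ.<-asym asc) = refl
    ... | tri< q<a _ _ rewrite <?-true q<a | <?-true (ℕₚ.<-trans q<a (inject₁<suc i))
      with compare-at v-inj (<⇒≢ (ℕₚ.<-trans q<a (inject₁<suc i)))
    ...   | inj₁ vq<vb rewrite <?-true vq<vb | <?-false (ℕₚ.<-asym vq<vb) | Boolₚ.∧-identityʳ (does (v a Fin.<? v q)) = refl
    ...   | inj₂ vb<vq rewrite <?-true vb<vq | <?-false (ℕₚ.<-asym vb<vq) | <?-true (ℕₚ.<-trans asc vb<vq) = refl

  -- After reindexing q ↦ sᵢ q, which the count does not see.
  largerBefore-s : ∀ p → largerBefore (v ∘ s i) p ≡ countFin λ q → does (s i q Fin.<? p) ∧ does (v (s i p) Fin.<? v q)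
  largerBefore-s p = trans
    (countFin-cong λ q → cong (λ z → does (z Fin.<? p) ∧ does (v (s i p) Fin.<? v (s i q))) (sym (s-involutive i q)))
    (countFin-s i λ q → does (s i q Fin.<? p) ∧ does (v (s i p) Fin.<? v q))

  largerBefore-s-left : largerBefore (v ∘ s i) a ≡ largerBefore v b
  largerBefore-s-left = trans (largerBefore-s a) (countFin-cong pointwise)
    where
    pointwise : ∀ q → does (s i q Fin.<? a) ∧ does (v (s i a) Fin.<? v q) ≡ does (q Fin.<? b) ∧ does (v b Fin.<? v q)
    pointwise q rewrite s-left i with transposeView a b q
    ... | isLeft refl rewrite <?-false (ℕₚ.<-asym asc) = trans (Boolₚ.∧-zeroʳ _) (sym (Boolₚ.∧-zeroʳ _))
    ... | isRight refl rewrite <?-false {x = v b} {y = v b} (ℕₚ.<-irrefl refl) = trans (Boolₚ.∧-zeroʳ _) (sym (Boolₚ.∧-zeroʳ _))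
    ... | isOther q≢a q≢b rewrite transpose-other a b q≢a q≢b = cong (_∧ does (v b Fin.<? v q))
      (does-⇔ (mk⇔ (λ q<a → ℕₚ.<-trans q<a (inject₁<suc i))
                   (λ q<b → [ id , (λ a<q → contradiction q<b (ℕₚ.≤⇒≯ (a<⇒b≤ a<q))) ]′ (≢⇒<⊎> q≢a)))
              (q Fin.<? a) (q Fin.<? b))

  -- The larger value `v b` now stands just in front of `v a` and adds one. This matches the
  -- negative entry of `ṡ⁻¹`.
  largerBefore-s-right : largerBefore (v ∘ s i) b ≡ suc (largerBefore v a)
  largerBefore-s-right = trans (largerBefore-s b) (trans (count-remove (λ q → does (s i q Fin.<? b) ∧ does (v (s i b) Fin.<? v q)) {b} at-b) (cong suc (countFin-cong pointwise)))
    where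
    at-b : does (s i b Fin.<? b) ∧ does (v (s i b) Fin.<? v b) ≡ true
    at-b rewrite s-right i | <?-true asc | <?-true (inject₁<suc i) = refl
    pointwise : ∀ q → (does (s i q Fin.<? b) ∧ does (v (s i b) Fin.<? v q)) ∧ not (does (q Fin.≟ b)) ≡
                does (q Fin.<? a) ∧ does (v a Fin.<? v q)
    pointwise q rewrite s-right i with transposeView a b q
    ... | isLeft refl rewrite <?-false {x = v a} {y = v a} (ℕₚ.<-irrefl refl) =
      trans (cong (_∧ not (does (a Fin.≟ b))) (Boolₚ.∧-zeroʳ (does (s i a Fin.<? b)))) (sym (Boolₚ.∧-zeroʳ _))
    ... | isRight refl rewrite dec-true (b Fin.≟ b) refl | <?-false (ℕₚ.<-asym (inject₁<suc i)) = Boolₚ.∧-zeroʳ _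
    ... | isOther q≢a q≢b rewrite transpose-other a b q≢a q≢b | dec-false (q Fin.≟ b) q≢b =
      trans (Boolₚ.∧-identityʳ _) (cong (_∧ does (v a Fin.<? v q))
        (does-⇔ (mk⇔ (λ q<b → [ id , (λ a<q → contradiction q<b (ℕₚ.≤⇒≯ (a<⇒b≤ a<q))) ]′ (≢⇒<⊎> q≢a))
                     (λ q<a → ℕₚ.<-trans q<a (inject₁<suc i)))
                (q Fin.<? b) (q Fin.<? a)))

  largerBefore-s-other : ∀ {p} → p ≢ a → p ≢ b → largerBefore (v ∘ s i) p ≡ largerBefore v p
  largerBefore-s-other {p} p≢a p≢b = trans (largerBefore-s p) (countFin-cong pointwise)
    where
    sp : s i p ≡ p
    sp = transpose-other a b p≢a p≢b
    s< : ∀ {q} → s i q Fin.< p → q Fin.< p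
    s< {q} lt with s-mono i lt
    ... | inj₁ (_ , p≡b) = contradiction p≡b p≢b
    ... | inj₂ lt′ = subst₂ Fin._<_ (s-involutive i q) sp lt′
    <s : ∀ {q} → q Fin.< p → s i q Fin.< p
    <s {q} lt with s-mono i lt
    ... | inj₁ (_ , p≡b) = contradiction p≡b p≢b
    ... | inj₂ lt′ = subst (s i q Fin.<_) sp lt′
    pointwise : ∀ q → does (s i q Fin.<? p) ∧ does (v (s i p) Fin.<? v q) ≡ does (q Fin.<? p) ∧ does (v p Fin.<? v q)
    pointwise q = cong₂ (λ b z → b ∧ does (v z Fin.<? v q)) (does-⇔ (mk⇔ s< <s) (s i q Fin.<? p) (q Fin.<? p)) sp

length-bridgesOf : ∀ {m} (v : Perm (suc m)) e → length (bridgesOf v e) ≡ nParams e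
length-bridgesOf v []                = refl
length-bridgesOf v ((i , true)  ∷ e) = length-bridgesOf (v ∘ s i) e
length-bridgesOf v ((i , false) ∷ e) =
  trans (Listₚ.length-++ (bridgesOf v e)) (trans (ℕₚ.+-comm _ 1) (cong suc (length-bridgesOf v e)))

-- Matrices

module Matrices {c ℓ′ : Level} (F : ACField₀ c ℓ′) where
  open Param F
  private R = ACField₀.cring F
  open CommutativeRing R using (Carrier; _≈_; 0#; 1#; -_; setoid; semiring; ring; +-cong; +-congˡ; *-cong; *-congˡ;
    *-congʳ; +-identityˡ; +-identityʳ; *-identityˡ; *-identityʳ; zeroˡ; zeroʳ; distribˡ; distribʳ; *-assoc; *-comm; -‿cong; reflexive)
    renaming (_+_ to _⊕_; _*_ to _⊛_; refl to ≈-refl; sym to ≈-sym; trans to ≈-trans)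
  open import Algebra.Properties.Semiring.Sum semiring using (sum; sum-cong-≋; ∑-comm; *-distribˡ-sum; *-distribʳ-sum)
  open import Algebra.Properties.Ring ring using (-‿distribˡ-*; -‿distribʳ-*; -‿involutive; -1*x≈-x)
  open import Relation.Binary.Reasoning.Setoid setoid

  infix 4 _≋_
  _≋_ : ∀ {r q} → Mat r q → Mat r q → Set ℓ′
  A ≋ B = ∀ i j → A i j ≈ B i j

  ≋-sym : ∀ {r q} {A B : Mat r q} → A ≋ B → B ≋ A
  ≋-sym eq i j = ≈-sym (eq i j)

  infixr 4 _⟫_
  _⟫_ : ∀ {r q} {A B C : Mat r q} → A ≋ B → B ≋ C → A ≋ C
  (eq ⟫ eq′) i j = ≈-trans (eq i j) (eq′ i j)

  Σ≈sum : ∀ {n} (f : Fin n → Carrier) → Σ[ f ] ≈ sum f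
  Σ≈sum {zero}  f = ≈-refl
  Σ≈sum {suc n} f = +-congˡ (Σ≈sum (f ∘ suc))

  Σ-cong : ∀ {n} {f g : Fin n → Carrier} → (∀ i → f i ≈ g i) → Σ[ f ] ≈ Σ[ g ]
  Σ-cong {zero}  eq = ≈-refl
  Σ-cong {suc n} eq = +-cong (eq zero) (Σ-cong (eq ∘ suc))

  ·-cong : ∀ {r p q} {A A′ : Mat r p} {B B′ : Mat p q} → A ≋ A′ → B ≋ B′ → A · B ≋ A′ · B′
  ·-cong eqA eqB i j = Σ-cong λ l → *-cong (eqA i l) (eqB l j)

  ·-congˡ : ∀ {r p q} (A : Mat r p) {B B′ : Mat p q} → B ≋ B′ → A · B ≋ A · B′
  ·-congˡ A = ·-cong {A = A} (λ _ _ → ≈-refl)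

  ·-congʳ : ∀ {r p q} {A A′ : Mat r p} (B : Mat p q) → A ≋ A′ → A · B ≋ A′ · B
  ·-congʳ B eq = ·-cong {B = B} eq (λ _ _ → ≈-refl)

  ·-assoc : ∀ {r p q n} (A : Mat r p) (B : Mat p q) (C : Mat q n) → (A · B) · C ≋ A · (B · C)
  ·-assoc A B C i j = begin
    Σ[ (λ l → Σ[ (λ h → A i h ⊛ B h l) ] ⊛ C l j) ]
      ≈⟨ Σ-cong (λ l → ≈-trans (*-congʳ (Σ≈sum λ h → A i h ⊛ B h l)) (*-distribʳ-sum (C l j) λ h → A i h ⊛ B h l)) ⟩
    Σ[ (λ l → sum λ h → (A i h ⊛ B h l) ⊛ C l j) ]
      ≈⟨ Σ≈sum (λ l → sum λ h → (A i h ⊛ B h l) ⊛ C l j) ⟩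
    sum (λ l → sum λ h → (A i h ⊛ B h l) ⊛ C l j)
      ≈⟨ ∑-comm (λ l h → (A i h ⊛ B h l) ⊛ C l j) ⟩
    sum (λ h → sum λ l → (A i h ⊛ B h l) ⊛ C l j)
      ≈⟨ sum-cong-≋ (λ h → sum-cong-≋ (λ l → *-assoc (A i h) (B h l) (C l j))) ⟩
    sum (λ h → sum λ l → A i h ⊛ (B h l ⊛ C l j))
      ≈⟨ sum-cong-≋ (λ h → ≈-trans (≈-sym (*-distribˡ-sum (A i h) λ l → B h l ⊛ C l j)) (*-congˡ (≈-sym (Σ≈sum λ l → B h l ⊛ C l j)))) ⟩
    sum (λ h → A i h ⊛ Σ[ (λ l → B h l ⊛ C l j) ])
      ≈⟨ Σ≈sum (λ h → A i h ⊛ Σ[ (λ l → B h l ⊛ C l j) ]) ⟨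
    Σ[ (λ h → A i h ⊛ Σ[ (λ l → B h l ⊛ C l j) ]) ] ∎

  Σ-zero : ∀ {n} (f : Fin n → Carrier) → (∀ l → f l ≈ 0#) → Σ[ f ] ≈ 0#
  Σ-zero {zero}  f eq = ≈-refl
  Σ-zero {suc n} f eq = ≈-trans (+-cong (eq zero) (Σ-zero (f ∘ suc) (eq ∘ suc))) (+-identityˡ 0#)

  Σ-δˡ : ∀ {n} (p : Fin n) c (X : Fin n → Carrier) → Σ[ (λ l → (if does (p Fin.≟ l) then c else 0#) ⊛ X l) ] ≈ c ⊛ X p
  Σ-δˡ zero c X = ≈-trans (+-congˡ (Σ-zero (λ l → 0# ⊛ X (suc l)) λ l → zeroˡ (X (suc l)))) (+-identityʳ _)
  Σ-δˡ (suc p) c X = ≈-trans (+-cong (zeroˡ (X zero)) (Σ-δˡ p c (X ∘ suc))) (+-identityˡ _)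

  Σ-δʳ : ∀ {n} (p : Fin n) c (X : Fin n → Carrier) → Σ[ (λ l → X l ⊛ (if does (l Fin.≟ p) then c else 0#)) ] ≈ X p ⊛ c
  Σ-δʳ zero c X = ≈-trans (+-congˡ (Σ-zero (λ l → X (suc l) ⊛ 0#) λ l → zeroʳ (X (suc l)))) (+-identityʳ _)
  Σ-δʳ (suc p) c X = ≈-trans (+-cong (zeroʳ (X zero)) (Σ-δʳ p c (X ∘ suc))) (+-identityˡ _)

  Σ-⊕ : ∀ {n} (f g : Fin n → Carrier) → Σ[ (λ l → f l ⊕ g l) ] ≈ Σ[ f ] ⊕ Σ[ g ]
  Σ-⊕ f g = ≈-trans (Σ≈sum λ l → f l ⊕ g l) (≈-trans (∑-distrib-+ f g) (+-cong (≈-sym (Σ≈sum f)) (≈-sym (Σ≈sum g))))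
    where open import Algebra.Properties.Semiring.Sum semiring using (∑-distrib-+)

  -- One form for `lollipopMat`, the signed permutation matrices and the row changes in the final
  -- comparison: multiplying by it on the left selects and rescales rows.
  Monomial : ∀ {r n} → (Fin r → Fin n) → (Fin r → Carrier) → Mat r n
  Monomial π c p q = if does (π p Fin.≟ q) then c p else 0#

  Monomial-· : ∀ {r p q} (π : Fin r → Fin p) (c : Fin r → Carrier) (X : Mat p q) i j →
               (Monomial π c · X) i j ≈ c i ⊛ X (π i) j
  Monomial-· π c X i j = Σ-δˡ (π i) (c i) (λ l → X l j)

  ·-identityˡ : ∀ {r q} (X : Mat r q) → 1M · X ≋ X
  ·-identityˡ X i j = ≈-trans (Σ-δˡ i 1# (λ l → X l j)) (*-identityˡ _)

  ·-identityʳ : ∀ {r q} (X : Mat r q) → X · 1M ≋ X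
  ·-identityʳ X i j = ≈-trans (Σ-δʳ j 1# (X i)) (*-identityʳ _)

  -- `xE` overwrites the entry `(a , b)`; off the diagonal this amounts to adding `t` there, so
  -- products with `xE` reduce to one row or column operation.
  xE-split : ∀ {n} {a b : Fin n} → a ≢ b → ∀ t l q →
             xE a b t l q ≈ 1M l q ⊕ (if does (l Fin.≟ a) then (if does (q Fin.≟ b) then t else 0#) else 0#)
  xE-split {a = a} {b} a≢b t l q with l Fin.≟ a
  ... | no _ = ≈-sym (+-identityʳ _)
  ... | yes refl with q Fin.≟ b
  ...   | no _ = ≈-sym (+-identityʳ _)
  ...   | yes refl rewrite dec-false (a Fin.≟ b) a≢b = ≈-sym (+-identityˡ t)

  ·-xE : ∀ {r n} (Y : Mat r n) {a b : Fin n} → a ≢ b → ∀ t p q →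
         (Y · xE a b t) p q ≈ Y p q ⊕ Y p a ⊛ (if does (q Fin.≟ b) then t else 0#)
  ·-xE Y {a} {b} a≢b t p q = begin
    Σ[ (λ l → Y p l ⊛ xE a b t l q) ]
      ≈⟨ Σ-cong (λ l → ≈-trans (*-congˡ (xE-split a≢b t l q)) (distribˡ (Y p l) (1M l q) (E l))) ⟩
    Σ[ (λ l → Y p l ⊛ 1M l q ⊕ Y p l ⊛ E l) ]
      ≈⟨ Σ-⊕ (λ l → Y p l ⊛ 1M l q) (λ l → Y p l ⊛ E l) ⟩
    (Y · 1M) p q ⊕ Σ[ (λ l → Y p l ⊛ E l) ]
      ≈⟨ +-cong (·-identityʳ Y p q) (Σ-δʳ a (if does (q Fin.≟ b) then t else 0#) (Y p)) ⟩
    Y p q ⊕ Y p a ⊛ (if does (q Fin.≟ b) then t else 0#) ∎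
    where
    E : Fin _ → Carrier
    E l = if does (l Fin.≟ a) then (if does (q Fin.≟ b) then t else 0#) else 0#

  xE-· : ∀ {n q} (X : Mat n q) {a b : Fin n} → a ≢ b → ∀ t p j →
         (xE a b t · X) p j ≈ X p j ⊕ (if does (p Fin.≟ a) then t else 0#) ⊛ X b j
  xE-· X {a} {b} a≢b t p j = begin
    Σ[ (λ l → xE a b t p l ⊛ X l j) ]
      ≈⟨ Σ-cong (λ l → ≈-trans (*-congʳ (≈-trans (xE-split a≢b t p l) (+-congˡ (swapped l)))) (distribʳ (X l j) (1M p l) (E l))) ⟩
    Σ[ (λ l → 1M p l ⊛ X l j ⊕ E l ⊛ X l j) ]
      ≈⟨ Σ-⊕ (λ l → 1M p l ⊛ X l j) (λ l → E l ⊛ X l j) ⟩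
    (1M · X) p j ⊕ Σ[ (λ l → E l ⊛ X l j) ]
      ≈⟨ +-cong (·-identityˡ X p j) (Σ-δˡ b (if does (p Fin.≟ a) then t else 0#) (λ l → X l j)) ⟩
    X p j ⊕ (if does (p Fin.≟ a) then t else 0#) ⊛ X b j ∎
    where
    E : Fin _ → Carrier
    E l = if does (b Fin.≟ l) then (if does (p Fin.≟ a) then t else 0#) else 0#
    swapped : ∀ l → (if does (p Fin.≟ a) then (if does (l Fin.≟ b) then t else 0#) else 0#) ≈ E l
    swapped l with p Fin.≟ a
    ... | yes _ = reflexive (cong (if_then t else 0#) (does-⇔ (mk⇔ sym sym) (l Fin.≟ b) (b Fin.≟ l)))
    ... | no _ with does (b Fin.≟ l)
    ...   | true  = ≈-refl
    ...   | false = ≈-refl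

  sgn : ℕ → Carrier
  sgn zero    = 1#
  sgn (suc n) = - sgn n

  sgn-+ : ∀ m n → sgn (m + n) ≈ sgn m ⊛ sgn n
  sgn-+ zero    n = ≈-sym (*-identityˡ _)
  sgn-+ (suc m) n = ≈-trans (-‿cong (sgn-+ m n)) (-‿distribˡ-* _ _)

  sgn² : ∀ n → sgn n ⊛ sgn n ≈ 1#
  sgn² zero    = *-identityˡ 1#
  sgn² (suc n) = begin
    - sgn n ⊛ - sgn n    ≈⟨ -‿distribˡ-* (sgn n) (- sgn n) ⟨
    - (sgn n ⊛ - sgn n)  ≈⟨ -‿cong (-‿distribʳ-* (sgn n) (sgn n)) ⟨
    - - (sgn n ⊛ sgn n)  ≈⟨ -‿involutive _ ⟩
    sgn n ⊛ sgn n        ≈⟨ sgn² n ⟩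
    1# ∎

  odd-sgn : ∀ n t → (if odd n then - t else t) ≈ sgn n ⊛ t
  odd-sgn zero    t = ≈-sym (*-identityˡ t)
  odd-sgn (suc n) t = begin
    (if not (odd n) then - t else t)  ≈⟨ negate (odd n) ⟩
    - (if odd n then - t else t)      ≈⟨ -‿cong (odd-sgn n t) ⟩
    - (sgn n ⊛ t)                     ≈⟨ -‿distribˡ-* (sgn n) t ⟩
    - sgn n ⊛ t ∎
    where
    negate : ∀ b → (if not b then - t else t) ≈ - (if b then - t else t)
    negate true  = ≈-sym (-‿involutive t)
    negate false = ≈-refl

  -- The parity test inside oddBetween is a local function, so the type of parity can only be left to unification.
  mutual
    oddBetween-odd : ∀ {k n} (I : Fin k → Fin n) a b →
                     oddBetween I a b ≡ odd (countFin λ r → does (a Fin.<? I r) ∧ does (I r Fin.<? b))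
    oddBetween-odd I a b with countFin (λ r → does (a Fin.<? I r) ∧ does (I r Fin.<? b))
    ... | x = parity I a b x

    parity : ∀ {k n} (I : Fin k → Fin n) a b x → _ ≡ odd x
    parity I a b zero          = refl
    parity I a b (suc zero)    = refl
    parity I a b (suc (suc x)) = trans (parity I a b x) (sym (Boolₚ.not-involutive (odd x)))

  -- A closed form of v̇⁻¹: by `signed-id` and `ṡ⁻¹-signed` it is the product of the factors `ṡ⁻¹ i`
  -- along a chain of ascents from `id` to `v`.
  signed : ∀ {n} → Perm n → Mat n n
  signed v = Monomial v (sgn ∘ largerBefore v)

  signed-id : ∀ {n} → signed {n} id ≋ 1M
  signed-id p q with does (p Fin.≟ q)
  ... | false = ≈-refl
  ... | true = reflexive (cong sgn (count-false _ λ q → none q))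
    where
    none : ∀ q → does (q Fin.<? p) ∧ does (p Fin.<? q) ≡ false
    none q with q Fin.<? p
    ... | no q≮p rewrite <?-false q≮p = refl
    ... | yes q<p rewrite <?-false (ℕₚ.<-asym q<p) = Boolₚ.∧-zeroʳ _

  ṡ⁻¹-monomial : ∀ {m} (i : Fin m) → ṡ⁻¹ i ≋ Monomial (s i) (λ p → if does (p Fin.≟ suc i) then - 1# else 1#)
  ṡ⁻¹-monomial i p q with transposeView (inject₁ i) (suc i) p
  ... | isLeft refl rewrite s-left i | dec-true (p Fin.≟ p) refl | dec-false (p Fin.≟ suc i) (<⇒≢ (inject₁<suc i)) =
    reflexive (cong (if_then 1# else 0#) (does-⇔ (mk⇔ sym sym) (q Fin.≟ suc i) (suc i Fin.≟ q)))
  ... | isRight refl rewrite s-right i | dec-true (i Fin.≟ i) refl | dec-false (p Fin.≟ inject₁ i) (<⇒≢ (inject₁<suc i) ∘ sym) =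
    reflexive (cong (if_then - 1# else 0#) (does-⇔ (mk⇔ sym sym) (q Fin.≟ inject₁ i) (inject₁ i Fin.≟ q)))
  ... | isOther p≢a p≢b rewrite transpose-other (inject₁ i) (suc i) p≢a p≢b
      | dec-false (p Fin.≟ inject₁ i) p≢a | dec-false (p Fin.≟ suc i) p≢b = ≈-refl

  module _ {m} {v : Perm (suc m)} (v-inj : Inj v) (i : Fin m) (asc : v (inject₁ i) Fin.< v (suc i)) where

    private
      ite-cong : ∀ b {x y} → x ≈ y → (if b then x else 0#) ≈ (if b then y else 0#)
      ite-cong true  eq = eq
      ite-cong false eq = ≈-refl

      ite-* : ∀ b x y → x ⊛ (if b then y else 0#) ≈ (if b then x ⊛ y else 0#)
      ite-* true  x y = ≈-refl
      ite-* false x y = zeroʳ x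

    ṡ⁻¹-signed : ṡ⁻¹ i · signed v ≋ signed (v ∘ s i)
    ṡ⁻¹-signed p q = begin
      (ṡ⁻¹ i · signed v) p q                      ≈⟨ ·-congʳ (signed v) (ṡ⁻¹-monomial i) p q ⟩
      (Monomial (s i) ε · signed v) p q           ≈⟨ Monomial-· (s i) ε (signed v) p q ⟩
      ε p ⊛ signed v (s i p) q                    ≈⟨ ite-* (does (v (s i p) Fin.≟ q)) (ε p) _ ⟩
      (if does (v (s i p) Fin.≟ q) then ε p ⊛ sgn (largerBefore v (s i p)) else 0#)
                                                  ≈⟨ ite-cong (does (v (s i p) Fin.≟ q)) signs ⟩
      signed (v ∘ s i) p q ∎
      where
      ε : Fin (suc m) → Carrier
      ε p = if does (p Fin.≟ suc i) then - 1# else 1#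
      signs : ε p ⊛ sgn (largerBefore v (s i p)) ≈ sgn (largerBefore (v ∘ s i) p)
      signs with transposeView (inject₁ i) (suc i) p
      ... | isLeft refl rewrite dec-false (p Fin.≟ suc i) (<⇒≢ (inject₁<suc i)) | largerBefore-s-left v-inj i asc | s-left i =
        *-identityˡ _
      ... | isRight refl rewrite dec-true (i Fin.≟ i) refl | largerBefore-s-right v-inj i asc | s-right i = -1*x≈-x _
      ... | isOther p≢a p≢b rewrite dec-false (p Fin.≟ suc i) p≢b | largerBefore-s-other v-inj i asc p≢a p≢b
          | transpose-other (inject₁ i) (suc i) p≢a p≢b = *-identityˡ _

    -- Conjugation by `signed v` moves the off-diagonal entry from row and column `inject₁ i`,
    -- `suc i` to `v (inject₁ i)`, `v (suc i)`. It picks up the signs of the two rows, whose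
    -- exponents differ by `leftCount v i`.
    xs-signed : ∀ {t t′} → t′ ≈ sgn (leftCount v i) ⊛ t →
                xs i t · signed v ≋ signed v · xE (v (inject₁ i)) (v (suc i)) t′
    xs-signed {t} {t′} t′≈ p q = begin
      (xs i t · signed v) p q
        ≈⟨ xE-· (signed v) (<⇒≢ (inject₁<suc i)) t p q ⟩
      signed v p q ⊕ (if does (p Fin.≟ a) then t else 0#) ⊛ signed v b q
        ≈⟨ +-congˡ entries ⟩
      signed v p q ⊕ signed v p (v a) ⊛ (if does (q Fin.≟ v b) then t′ else 0#)
        ≈⟨ ·-xE (signed v) (<⇒≢ asc) t′ p q ⟨
      (signed v · xE (v a) (v b) t′) p q ∎
      where
      a b : Fin (suc m)
      a = inject₁ i
      b = suc i
      signs : t ⊛ sgn (largerBefore v b) ≈ sgn (largerBefore v a) ⊛ t′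
      signs = begin
        t ⊛ B                ≈⟨ *-comm t B ⟩
        B ⊛ t                ≈⟨ *-congˡ (*-identityˡ t) ⟨
        B ⊛ (1# ⊛ t)         ≈⟨ *-congˡ (*-congʳ (sgn² (leftCount v i))) ⟨
        B ⊛ ((C ⊛ C) ⊛ t)    ≈⟨ *-congˡ (*-assoc C C t) ⟩
        B ⊛ (C ⊛ (C ⊛ t))    ≈⟨ *-assoc B C (C ⊛ t) ⟨
        (B ⊛ C) ⊛ (C ⊛ t)    ≈⟨ *-cong (≈-sym (sgn-+ (largerBefore v b) (leftCount v i))) (≈-sym t′≈) ⟩
        sgn (largerBefore v b + leftCount v i) ⊛ t′ ≈⟨ *-congʳ (reflexive (cong sgn (sym (largerBefore-ascent v-inj i asc)))) ⟩
        sgn (largerBefore v a) ⊛ t′ ∎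
        where
        B = sgn (largerBefore v b)
        C = sgn (leftCount v i)
      entries : (if does (p Fin.≟ a) then t else 0#) ⊛ signed v b q ≈ signed v p (v a) ⊛ (if does (q Fin.≟ v b) then t′ else 0#)
      entries with p Fin.≟ a
      ... | no p≢a rewrite dec-false (v p Fin.≟ v a) (p≢a ∘ v-inj) = ≈-trans (zeroˡ _) (≈-sym (zeroˡ _))
      ... | yes refl rewrite dec-true (v p Fin.≟ v p) refl | does-⇔ (mk⇔ sym sym) (q Fin.≟ v b) (v b Fin.≟ q) =
        ≈-trans (ite-* (does (v b Fin.≟ q)) t _)
          (≈-trans (ite-cong (does (v b Fin.≟ q)) signs) (≈-sym (ite-* (does (v b Fin.≟ q)) _ t′)))

  module _ {k n} (I : Fin k → Fin n) where

    weight : Fin n → Fin n → Carrier → Carrier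
    weight a b t = if oddBetween I a b then - t else t

    -- The weights come from an infinite sequence, so that appending a bridge needs no reindexing.
    bridgeSeq : Bridges n → (ℕ → Carrier) → Mat n n
    bridgeSeq []             τ = 1M
    bridgeSeq ((a , b) ∷ bs) τ = xE a b (weight a b (τ 0)) · bridgeSeq bs (τ ∘ suc)

    bridgeSeq-∷ʳ : ∀ bs {a b} τ → bridgeSeq (bs ∷ʳ (a , b)) τ ≋ bridgeSeq bs τ · xE a b (weight a b (τ (length bs)))
    bridgeSeq-∷ʳ [] τ = ·-identityʳ _ ⟫ ≋-sym (·-identityˡ _)
    bridgeSeq-∷ʳ ((a , b) ∷ bs) τ = ·-congˡ X (bridgeSeq-∷ʳ bs (τ ∘ suc)) ⟫ ≋-sym (·-assoc X (bridgeSeq bs (τ ∘ suc)) (xE _ _ _))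
      where X = xE a b (weight a b (τ 0))

    bridgeProd≋bridgeSeq : ∀ bs {t τ} → (∀ j → t j ≡ τ (toℕ j)) → bridgeProd I bs t ≋ bridgeSeq bs τ
    bridgeProd≋bridgeSeq []             eq i j = ≈-refl
    bridgeProd≋bridgeSeq ((a , b) ∷ bs) eq =
      ·-cong (λ i j → reflexive (cong (λ z → xE a b (weight a b z) i j) (eq zero))) (bridgeProd≋bridgeSeq bs (eq ∘ suc))

  -- `signed v` absorbs each letter of 𝐮 and passes to the left of every other factor, turning it
  -- into a bridge factor. The subtraction in the index of `τ` reverses the parameters, as the first
  -- letter gives the last bridge.
  deodharMat-signed : ∀ {m k} {I : Fin k → Fin (suc m)} (e : Expr m) {v : Perm (suc m)} → Inj v →
    PositiveFrom v e → SignsMatch I v e → ∀ t τ → (∀ j → t j ≡ τ (nParams e ∸ suc (toℕ j))) →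
    deodharMat e t · signed v ≋ signed (subProdFrom v e) · bridgeSeq I (bridgesOf v e) τ
  deodharMat-signed [] {v} v-inj _ _ t τ _ = ·-identityˡ (signed v) ⟫ ≋-sym (·-identityʳ (signed v))
  deodharMat-signed ((i , true) ∷ e) {v} v-inj (up , pos) signs t τ eq =
    ·-assoc (deodharMat e t) (ṡ⁻¹ i) (signed v)
    ⟫ ·-congˡ (deodharMat e t) (ṡ⁻¹-signed v-inj i (ℓ<⇒ascent v-inj i up))
    ⟫ deodharMat-signed e (∘-s-injective i v-inj) pos signs t τ eq
  deodharMat-signed {I = I} ((i , false) ∷ e) {v} v-inj (up , pos) (count≡ , signs) t τ eq =
    ·-assoc D (xs i (t zero)) (signed v)
    ⟫ ·-congˡ D (xs-signed v-inj i (ℓ<⇒ascent v-inj i up) weight≈)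
    ⟫ ≋-sym (·-assoc D (signed v) X)
    ⟫ ·-congʳ X (deodharMat-signed e v-inj pos signs (t ∘ suc) τ (eq ∘ suc))
    ⟫ ·-assoc S (bridgeSeq I (bridgesOf v e) τ) X
    ⟫ ·-congˡ S (≋-sym (bridgeSeq-∷ʳ I (bridgesOf v e) τ))
    where
    D = deodharMat e (t ∘ suc)
    S = signed (subProdFrom v e)
    a = v (inject₁ i)
    b = v (suc i)
    X = xE a b (weight I a b (τ (length (bridgesOf v e))))
    weight≈ : weight I a b (τ (length (bridgesOf v e))) ≈ sgn (leftCount v i) ⊛ t zero
    weight≈ rewrite oddBetween-odd I a b | count≡ | length-bridgesOf v e | eq zero = odd-sgn (leftCount v i) (τ (nParams e))

  extend : ∀ {d} → (Fin d → Carrier) → ℕ → Carrier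
  extend {zero}  t x       = 0#
  extend {suc d} t zero    = t zero
  extend {suc d} t (suc x) = extend (t ∘ suc) x

  extend-toℕ : ∀ {d} (t : Fin d → Carrier) j → t j ≡ extend t (toℕ j)
  extend-toℕ t zero    = refl
  extend-toℕ t (suc j) = extend-toℕ (t ∘ suc) j

-- Enumerated subsets and lollipop graphs

count-true : ∀ n → countFin {n} (λ _ → true) ≡ n
count-true zero    = refl
count-true (suc n) = cong suc (count-true n)

count-image : ∀ {k n} (p : Fin n → Bool) {g : Fin k → Fin n} → Inj g → (∀ r → p (g r) ≡ true) →
              (∀ c → p c ≡ true → ∃ λ r → g r ≡ c) → countFin p ≡ k
count-image {k} p {g} g-inj into onto = trans (ℕₚ.≤-antisym
  (count-≤ p (λ _ → true) {λ c r → g r ≡ c} (λ c pc → proj₁ (onto c pc) , refl , proj₂ (onto c pc)) λ p q → trans (sym p) q)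
  (count-≤ (λ _ → true) p {λ r c → g r ≡ c} (λ r _ → g r , into r , refl) λ p q → g-inj (trans p (sym q))))
  (count-true k)

-- A `BridgeGraph` lists its subset increasingly, while a Deodhar datum gives it as the first `k`
-- values of `u`, in any order.
record Enumeration {n} (p : Fin n → Bool) (k : ℕ) : Set where
  field
    enum       : Fin k → Fin n
    increasing : ∀ r r′ → r Fin.< r′ → enum r Fin.< enum r′
    sound      : ∀ r → p (enum r) ≡ true
    complete   : ∀ c → p c ≡ true → ∃ λ r → enum r ≡ c

enumerate : ∀ {n} (p : Fin n → Bool) → Enumeration p (countFin p)
enumerate {zero}  p = record { enum = λ () ; increasing = λ () ; sound = λ () ; complete = λ () }
enumerate {suc n} p with p zero in p₀ | enumerate (p ∘ suc)
... | true | E = record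
  { enum       = λ { zero → zero ; (suc r) → suc (enum r) }
  ; increasing = λ { zero (suc r′) _ → s≤s z≤n ; (suc r) (suc r′) (s≤s lt) → s≤s (increasing r r′ lt) }
  ; sound      = λ { zero → p₀ ; (suc r) → sound r }
  ; complete   = λ { zero _ → zero , refl ; (suc c) pc → suc (proj₁ (complete c pc)) , cong suc (proj₂ (complete c pc)) } }
  where open Enumeration E
... | false | E = record
  { enum       = suc ∘ enum
  ; increasing = λ r r′ lt → s≤s (increasing r r′ lt)
  ; sound      = sound
  ; complete   = λ { zero pc → contradiction (trans (sym pc) p₀) (λ ()) ; (suc c) pc → proj₁ (complete c pc) , cong suc (proj₂ (complete c pc)) } }
  where open Enumeration E

increasing⇒injective : ∀ {k n} {I : Fin k → Fin n} → (∀ r r′ → r Fin.< r′ → I r Fin.< I r′) → Inj I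
increasing⇒injective incr {r} {r′} eq with Finₚ.<-cmp r r′
... | tri< lt _ _ = contradiction eq (<⇒≢ (incr _ _ lt))
... | tri≈ _ r≡r′ _ = r≡r′
... | tri> _ _ gt = contradiction (sym eq) (<⇒≢ (incr _ _ gt))

lollipop-∈ : ∀ {k n} (I : Fin k → Fin n) {c} → (∃ λ r → I r ≡ c) → Shifted (lollipop I) c
lollipop-∈ I {c} c∈I rewrite dec-true (Finₚ.any? λ r → I r Fin.≟ c) c∈I = refl

lollipop-∉ : ∀ {k n} (I : Fin k → Fin n) {c} → (¬ ∃ λ r → I r ≡ c) → Fixed (lollipop I) c
lollipop-∉ I {c} c∉I rewrite dec-false (Finₚ.any? λ r → I r Fin.≟ c) c∉I = refl

∈-image? : ∀ {k n} (I : Fin k → Fin n) c → (∃ λ r → I r ≡ c) ⊎ (¬ ∃ λ r → I r ≡ c)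
∈-image? I c = toSum (Finₚ.any? λ r → I r Fin.≟ c)

lollipop-bounded : ∀ {k n} (I : Fin k → Fin n) → Bounded (lollipop I)
lollipop-bounded {n = n} I = record
  { lower≤ = λ c → [ (λ eq → ℕₚ.≤-trans (ℕₚ.m≤m+n (toℕ c) n) (ℕₚ.≤-reflexive (sym eq))) , (λ eq → ℕₚ.≤-reflexive (sym eq)) ]′ (cases c)
  ; ≤upper = λ c → [ ℕₚ.≤-reflexive , (λ eq → ℕₚ.≤-trans (ℕₚ.≤-reflexive eq) (ℕₚ.m≤m+n (toℕ c) n)) ]′ (cases c) }
  where
  cases : ∀ c → Shifted (lollipop I) c ⊎ Fixed (lollipop I) c
  cases c with ∈-image? I c
  ... | inj₁ c∈I = inj₁ (lollipop-∈ I c∈I)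
  ... | inj₂ c∉I = inj₂ (lollipop-∉ I c∉I)

fixed⇒¬shifted : ∀ {m} {f : Fin (suc m) → ℕ} {c} → Fixed f c → ¬ Shifted f c
fixed⇒¬shifted {m} {c = c} fx sh = ℕₚ.<-irrefl (trans (sym fx) sh) (ℕₚ.m<m+n (toℕ c) {suc m} (s≤s z≤n))

lollipop-fixed⇒∉ : ∀ {k m} (I : Fin k → Fin (suc m)) {c} → Fixed (lollipop I) c → ∀ r → I r ≢ c
lollipop-fixed⇒∉ I {c} fx r eq = fixed⇒¬shifted {f = lollipop I} {c} fx (lollipop-∈ I (r , eq))

lollipop-shifted⇒∈ : ∀ {k m} (I : Fin k → Fin (suc m)) {c} → Shifted (lollipop I) c → ∃ λ r → I r ≡ c
lollipop-shifted⇒∈ I {c} sh with ∈-image? I c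
... | inj₁ c∈I = c∈I
... | inj₂ c∉I = contradiction sh (fixed⇒¬shifted {f = lollipop I} {c} (lollipop-∉ I c∉I))

-- From a Deodhar datum to a bridge graph

subProdFrom-injective : ∀ {m} (e : Expr m) {v : Perm (suc m)} → Inj v → Inj (subProdFrom v e)
subProdFrom-injective []                v-inj = v-inj
subProdFrom-injective ((i , true)  ∷ e) v-inj = subProdFrom-injective e (∘-s-injective i v-inj)
subProdFrom-injective ((i , false) ∷ e) v-inj = subProdFrom-injective e v-inj

wordProd-injective : ∀ {m} (is : List (Fin m)) → Inj (wordProd is)
wordProd-injective []       eq = eq
wordProd-injective (i ∷ is) eq = wordProd-injective is (transpose-injective (inject₁ i) (suc i) eq)

Inj-cong : ∀ {n} {v w : Perm n} → (∀ x → v x ≡ w x) → Inj v → Inj w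
Inj-cong eq v-inj wx≡wy = v-inj (trans (eq _) (trans wx≡wy (sym (eq _))))

ℓ-id : ∀ m → ℓ {m} id ≡ 0
ℓ-id zero    = refl
ℓ-id (suc m) = cong₂ _+_ (count-false {m} _ λ _ → refl) (ℓ-id m)

-- Equality of `I` and u([k]) as sets, kept as a choice of indices: these become the row
-- permutations in `sameRowSpan`.
record Lists {m k} (k≤n : k ≤ suc m) (u : Perm (suc m)) (I : Fin k → Fin (suc m)) : Set where
  field
    to     : ∀ r → ∃ λ r′ → I r′ ≡ u (inject≤ r k≤n)
    from   : ∀ r′ → ∃ λ r → u (inject≤ r k≤n) ≡ I r′

-- `I` is a parameter so that the converse can apply the same comparison of maps to the datum it
-- constructs.
module FromDeodhar {m k} (k≤n : k ≤ suc m) (D : DeodharDatum m k) {I : Fin k → Fin (suc m)} (I-inj : Inj I)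
    (lists : Lists k≤n (DeodharDatum.u D) I) where
  open DeodharDatum D
  open Lists lists

  private
    u₁ w₁ : Perm (suc m)
    u₁ = subProdFrom id expr
    w₁ = wordProd (word expr)

    u₁≗u : ∀ x → u₁ x ≡ u x
    u₁≗u = proj₂ pds

    u-inj : Inj u
    u-inj = Inj-cong u₁≗u (subProdFrom-injective expr id)

    w-inj : Inj w
    w-inj = Inj-cong isWord (wordProd-injective (word expr))

    u<k : ∀ {x} → toℕ x < k → Shifted (lollipop I) (u₁ x)
    u<k {x} x<k with to (Fin.fromℕ< x<k)
    ... | r , eq = lollipop-∈ I (r , trans eq (trans (cong u (Finₚ.toℕ-injective
      (trans (Finₚ.toℕ-inject≤ _ k≤n) (Finₚ.toℕ-fromℕ< x<k)))) (sym (u₁≗u x))))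

    u≥k : ∀ {x} → k ≤ toℕ x → Fixed (lollipop I) (u₁ x)
    u≥k {x} k≤x = lollipop-∉ I λ { (r , eq) → ℕₚ.<⇒≱ (x<k r eq) k≤x }
      where
      x<k : ∀ r → I r ≡ u₁ x → toℕ x < k
      x<k r eq with from r
      ... | r₀ , eq₀ = subst (_< k) (trans (sym (Finₚ.toℕ-inject≤ r₀ k≤n)) (cong toℕ (u-inj (trans eq₀ (trans eq (u₁≗u x))))))
                                    (Finₚ.toℕ<n r₀)

  initial : State I u₁ w₁ (lollipop I)
  initial = record
    { bounded = lollipop-bounded I ; compatible = compat ; included = incl
    ; shifted⇒∈ = lollipop-shifted⇒∈ I ; fixed⇒∉ = lollipop-fixed⇒∉ I }
    where
    n : ℕ
    n = suc m
    compat : Compatible u₁ (lollipop I)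
    compat {x} {y} x<y _ with toℕ x ℕ.<? k
    ... | yes x<k = inj₁ (u<k x<k)
    ... | no  x≮k = inj₂ (u≥k (ℕₚ.≤-trans (ℕₚ.≮⇒≥ x≮k) (ℕₚ.<⇒≤ x<y)))
    -- A shifted label is at least `n` and a fixed one is below `n`. On one side of `k` all labels
    -- are of the same kind and compare like the values of `u`.
    straddling : ∀ {x y} → toℕ x < k → k ≤ toℕ y → lollipop I (u₁ y) < lollipop I (u₁ x)
    straddling {x} {y} x<k k≤y rewrite u<k x<k | u≥k k≤y = ℕₚ.<-≤-trans (Finₚ.toℕ<n (u₁ y)) (ℕₚ.m≤n+m n _)
    incl : InvIncluded w₁ (lollipop I ∘ u₁)
    incl {x} {y} x<y lt with ≤k⇒InvBound w-inj u≤kw x<y (subst₂ Fin._<_ (isWord y) (isWord x) lt)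
    ... | inj₂ (x<k , k≤y) = straddling x<k k≤y
    ... | inj₁ uy<ux with toℕ x ℕ.<? k | toℕ y ℕ.<? k
    ...   | yes x<k | no  y≮k = straddling x<k (ℕₚ.≮⇒≥ y≮k)
    ...   | yes x<k | yes y<k rewrite u<k x<k | u<k y<k =
      ℕₚ.+-monoˡ-< n (subst₂ Fin._<_ (sym (u₁≗u y)) (sym (u₁≗u x)) uy<ux)
    ...   | no  x≮k | yes y<k = contradiction (ℕₚ.<-trans x<y y<k) x≮k
    ...   | no  x≮k | no  y≮k rewrite u≥k {x} (ℕₚ.≮⇒≥ x≮k) | u≥k {y} (ℕₚ.≮⇒≥ y≮k) =
      subst₂ Fin._<_ (sym (u₁≗u y)) (sym (u₁≗u x)) uy<ux

  ascending : Ascending id (word expr)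
  ascending = reduced⇒ascending id (word expr)
    (ℕₚ.≤-reflexive (trans (cong (_+ length (word expr)) (ℓ-id (suc m))) (trans reduced (ℓ-cong (sym ∘ isWord)))))

  validity = deodhar⇒valid I-inj expr id (proj₁ pds) ascending initial

  validBridges : ValidBridges (lollipop I) (bridgesOf id expr)
  validBridges = proj₁ (proj₂ validity)

  module _ {c ℓ′ : Level} (F : ACField₀ c ℓ′) where
    open Param F
    open Matrices F
    open CommutativeRing (ACField₀.cring F) using (Carrier; _≈_; 1#; setoid; *-congˡ; *-congʳ; *-assoc; *-identityˡ; reflexive)
      renaming (_*_ to _⊛_; trans to ≈-trans)
    open import Relation.Binary.Reasoning.Setoid setoid

    -- Both matrices consist of the rows of `P` indexed by u([k]), in different orders and up to the
    -- signs `σ`, which square to 1. The list `bs` is kept apart from `bridgesOf id expr` because in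
    -- the converse the two are only propositionally equal.
    sameRowSpan : ∀ bs → bs ≡ bridgesOf id expr → (eq : length bs ≡ nParams expr) (t : Fin (nParams expr) → Carrier) →
                  SameRowSpan (firstRows k≤n (deodharMat expr t)) (lollipopMat I · bridgeProd I bs (t ∘ cast eq ∘ opposite))
    sameRowSpan bs refl eq t =
      (Monomial (proj₁ ∘ to) σ , λ r q → begin
        (Monomial (proj₁ ∘ to) σ · B) r q   ≈⟨ Monomial-· (proj₁ ∘ to) σ B r q ⟩
        σ r ⊛ B (proj₁ (to r)) q            ≈⟨ *-congˡ (B-row _ q) ⟩
        σ r ⊛ P (I (proj₁ (to r))) q        ≈⟨ reflexive (cong (λ z → σ r ⊛ P z q) (proj₂ (to r))) ⟩
        σ r ⊛ P (u (inject≤ r k≤n)) q       ≈⟨ A-row r q ⟨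
        A r q ∎) ,
      (Monomial (proj₁ ∘ from) (σ ∘ proj₁ ∘ from) , λ r q → begin
        (Monomial (proj₁ ∘ from) (σ ∘ proj₁ ∘ from) · A) r q  ≈⟨ Monomial-· (proj₁ ∘ from) (σ ∘ proj₁ ∘ from) A r q ⟩
        σ (proj₁ (from r)) ⊛ A (proj₁ (from r)) q             ≈⟨ *-congˡ (A-row _ q) ⟩
        σ (proj₁ (from r)) ⊛ (σ (proj₁ (from r)) ⊛ P (u (inject≤ (proj₁ (from r)) k≤n)) q)
                                                              ≈⟨ *-assoc _ _ _ ⟨
        (σ (proj₁ (from r)) ⊛ σ (proj₁ (from r))) ⊛ P (u (inject≤ (proj₁ (from r)) k≤n)) q
                                                              ≈⟨ *-congʳ (sgn² (largerBefore u₁ (inject≤ (proj₁ (from r)) k≤n))) ⟩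
        1# ⊛ P (u (inject≤ (proj₁ (from r)) k≤n)) q           ≈⟨ *-identityˡ _ ⟩
        P (u (inject≤ (proj₁ (from r)) k≤n)) q                ≈⟨ reflexive (cong (λ z → P z q) (proj₂ (from r))) ⟩
        P (I r) q                                             ≈⟨ B-row r q ⟨
        B r q ∎)
      where
      t′ : Fin (length bs) → Carrier
      t′ = t ∘ cast eq ∘ opposite
      P A₀ : Mat (suc m) (suc m)
      P = bridgeSeq I bs (extend t′)
      A₀ = deodharMat expr t
      A B : Mat k (suc m)
      A = firstRows k≤n A₀
      B = lollipopMat I · bridgeProd I bs t′
      σ : Fin k → Carrier
      σ r = sgn (largerBefore u₁ (inject≤ r k≤n))
      B-row : ∀ r q → B r q ≈ P (I r) q
      B-row r q = ≈-trans (Monomial-· I (λ _ → 1#) (bridgeProd I bs t′) r q)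
        (≈-trans (*-identityˡ _) (bridgeProd≋bridgeSeq I bs (extend-toℕ t′) (I r) q))
      reversed : ∀ j → t j ≡ extend t′ (nParams expr ∸ suc (toℕ j))
      reversed j = trans (cong t j≡) (trans (extend-toℕ t′ j′) (cong (extend t′) toℕ-j′))
        where
        j′ : Fin (length bs)
        j′ = opposite (cast (sym eq) j)
        j≡ : j ≡ cast eq (opposite j′)
        j≡ = Finₚ.toℕ-injective (sym (trans (Finₚ.toℕ-cast eq (opposite j′))
          (trans (cong toℕ (Finₚ.opposite-involutive (cast (sym eq) j))) (Finₚ.toℕ-cast (sym eq) j))))
        toℕ-j′ : toℕ j′ ≡ nParams expr ∸ suc (toℕ j)
        toℕ-j′ = trans (Finₚ.opposite-prop (cast (sym eq) j)) (cong₂ (λ d x → d ∸ suc x) eq (Finₚ.toℕ-cast (sym eq) j))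
      A₀≋ : A₀ ≋ signed u₁ · P
      A₀≋ = ≋-sym (·-identityʳ A₀) ⟫ ·-congˡ A₀ (≋-sym signed-id)
        ⟫ deodharMat-signed expr id (proj₁ pds) (proj₂ (proj₂ validity)) t (extend t′) reversed
      A-row : ∀ r q → A r q ≈ σ r ⊛ P (u (inject≤ r k≤n)) q
      A-row r q = ≈-trans (A₀≋ (inject≤ r k≤n) q)
        (≈-trans (Monomial-· u₁ (sgn ∘ largerBefore u₁) P (inject≤ r k≤n) q)
          (reflexive (cong (λ z → σ r ⊛ P z q) (u₁≗u (inject≤ r k≤n)))))

deodhar⇒bridgeGraph : ∀ {c ℓ′ : Level} (F : ACField₀ c ℓ′) {m k} (k≤n : k ≤ suc m) (D : DeodharDatum m k) →
                      ∃ λ (B : BridgeGraph (suc m) k) → Param.SameMap F k≤n D B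
deodhar⇒bridgeGraph F {m} {k} k≤n D = record
    { I = enum ; increasing = increasing ; bridges = bridgesOf id expr ; valid = validBridges }
  , length-bridgesOf id expr , λ t _ → sameRowSpan F (bridgesOf id expr) refl (length-bridgesOf id expr) t
  where
  open DeodharDatum D
  u′ : Fin k → Fin (suc m)
  u′ r = u (inject≤ r k≤n)
  u′-inj : Inj u′
  u′-inj {r} {r′} eq = Finₚ.inject≤-injective k≤n k≤n r r′ (Inj-cong (proj₂ pds) (subProdFrom-injective expr id) eq)
  p : Fin (suc m) → Bool
  p c = does (Finₚ.any? λ r → u′ r Fin.≟ c)
  p-true : ∀ r → p (u′ r) ≡ true
  p-true r = dec-true (Finₚ.any? λ r′ → u′ r′ Fin.≟ u′ r) (r , refl)
  true-p : ∀ c → p c ≡ true → ∃ λ r → u′ r ≡ c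
  true-p c = does-true (Finₚ.any? λ r → u′ r Fin.≟ c)
  open Enumeration (subst (Enumeration p) (count-image p u′-inj p-true true-p) (enumerate p))
  lists : Lists k≤n u enum
  lists = record { to = λ r → complete _ (p-true r) ; from = λ r → true-p _ (sound r) }
  open FromDeodhar k≤n D (increasing⇒injective increasing) lists

-- From a bridge graph to a Deodhar datum

does-false : ∀ {P : Set} (P? : Dec P) → does P? ≡ false → ¬ P
does-false (no ¬p) _ = ¬p

after-bounded : ∀ {n} {f : Fin n → ℕ} (bs : Bridges n) → ValidBridges f bs → Bounded f → Bounded (after f bs)
after-bounded []             _ bd = bd
after-bounded ((a , b) ∷ bs) (a<b , lt , _ , valid) bd = after-bounded bs valid (BridgeStep.bounded′ bd a<b lt)

-- A discrete intermediate value argument: walk from `α` towards `β` until the colour first changes.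
find-drop : ∀ {m} d (col : Fin (suc m) → Bool) (α β : Fin (suc m)) → toℕ β ≡ d + suc (toℕ α) → col α ≡ true → col β ≡ false →
            ∃ λ i → α Fin.≤ inject₁ i × suc i Fin.≤ β × col (inject₁ i) ≡ true × col (suc i) ≡ false
find-drop d col α β eq colα colβ with lower {a = α} {β} (subst (toℕ α <_) (sym eq) (ℕₚ.m≤n+m _ d))
... | i , refl with col (suc i) in col-suc
...   | false = i , ℕₚ.≤-refl , subst₂ _≤_ (cong suc (Finₚ.toℕ-inject₁ i)) (sym eq) (ℕₚ.m≤n+m _ d) , colα , col-suc
find-drop zero col .(inject₁ i) β eq colα colβ | i , refl | true
  with Finₚ.toℕ-injective {i = β} {suc i} (trans eq (cong suc (Finₚ.toℕ-inject₁ i)))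
... | refl = contradiction (trans (sym col-suc) colβ) λ ()
find-drop (suc d) col .(inject₁ i) β eq colα colβ | i , refl | true
  with find-drop d col (suc i) β (trans eq (trans (sym (ℕₚ.+-suc d _)) (cong (λ z → d + suc (suc z)) (Finₚ.toℕ-inject₁ i)))) col-suc colβ
... | j , le , rest = j , ℕₚ.≤-trans (ℕₚ.<⇒≤ (inject₁<suc i)) le , rest

-- A descent of `w` at `i` would be a descent of `F`, so `w` ascends there and the letter keeps the
-- word reduced. The inversion it creates in `w` is created in `F` as well.
InvIncluded-s : ∀ {m} {w : Perm (suc m)} {F : Fin (suc m) → ℕ} → Inj w → InvIncluded w F → ∀ i → F (inject₁ i) < F (suc i) →
                w (inject₁ i) Fin.< w (suc i) × InvIncluded (w ∘ s i) (F ∘ s i)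
InvIncluded-s {w = w} {F} w-inj incl i lt = ascent , incl′
  where
  ascent : w (inject₁ i) Fin.< w (suc i)
  ascent with compare-at w-inj (<⇒≢ (inject₁<suc i))
  ... | inj₁ asc = asc
  ... | inj₂ desc = contradiction (incl (inject₁<suc i) desc) (ℕₚ.<-asym lt)
  incl′ : InvIncluded (w ∘ s i) (F ∘ s i)
  incl′ x<y desc with s-mono i x<y
  ... | inj₁ (refl , refl) = subst₂ (λ p q → F p < F q) (sym (s-right i)) (sym (s-left i)) lt
  ... | inj₂ sx<sy = incl sx<sy desc

-- g is the bounded affine permutation of the whole bridge graph; f is what remains of it after removing
-- the bridges of the letters read so far.
record BuildState {m} (g : Fin (suc m) → ℕ) (v w : Perm (suc m)) (f : Fin (suc m) → ℕ) : Set where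
  field
    v-inj      : Inj v
    w-inj      : Inj w
    compatible : Compatible v f
    included   : InvIncluded w (f ∘ v)
    linked     : ∀ x → f (v x) ≡ g (w x)

-- `separated` puts the shifted lollipops before the fixed ones, so that the first `k` positions of
-- the final permutation carry `I`.
record Built {m} (g f₀ : Fin (suc m) → ℕ) (v w : Perm (suc m)) (bs : Bridges (suc m)) : Set where
  field
    expr      : Expr m
    positive  : PositiveFrom v expr
    ascending : Ascending w (word expr)
    bridges≡  : bridgesOf v expr ≡ bs
    final     : BuildState g (subProdFrom v expr) (w ∘ wordProd (word expr)) f₀
    separated : ∀ {x y} → x Fin.< y → Fixed f₀ (subProdFrom v expr x) → Fixed f₀ (subProdFrom v expr y)

module _ {m} {g : Fin (suc m) → ℕ} {v w : Perm (suc m)} {f : Fin (suc m) → ℕ} (st : BuildState g v w f) (i : Fin m) where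
  open BuildState st

  -- The exchange creates an inversion of `v`, which `Compatible` admits if its larger member is
  -- shifted or its smaller one fixed. With the bounds on `f`, the same condition makes the labels
  -- ascend at `i`, and hence `w`.
  swap-state : Bounded f → v (inject₁ i) Fin.< v (suc i) → Shifted f (v (suc i)) ⊎ Fixed f (v (inject₁ i)) →
               w (inject₁ i) Fin.< w (suc i) × BuildState g (v ∘ s i) (w ∘ s i) f
  swap-state bounded asc allowed = proj₁ step , record
    { v-inj = ∘-s-injective i v-inj ; w-inj = ∘-s-injective i w-inj ; compatible = compat
    ; included = proj₂ step ; linked = linked ∘ s i }
    where
    open Bounded bounded
    label< : Shifted f (v (suc i)) ⊎ Fixed f (v (inject₁ i)) → f (v (inject₁ i)) < f (v (suc i))
    label< (inj₁ sh) rewrite sh = ℕₚ.≤-<-trans (≤upper _) (ℕₚ.+-monoˡ-< (suc m) asc)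
    label< (inj₂ fx) rewrite fx = ℕₚ.<-≤-trans asc (lower≤ _)
    step = InvIncluded-s w-inj included i (label< allowed)
    compat : Compatible (v ∘ s i) f
    compat x<y desc with s-mono i x<y
    ... | inj₁ (refl , refl) = subst₂ (λ p q → Shifted f (v p) ⊎ Fixed f (v q)) (sym (s-left i)) (sym (s-right i)) allowed
    ... | inj₂ sx<sy = compatible sx<sy desc

  -- A descent here would require the fixed element to be shifted or the other one to be fixed.
  fixed-swap : Fixed f (v (inject₁ i)) → ¬ Fixed f (v (suc i)) → v (inject₁ i) Fin.< v (suc i)
  fixed-swap fx ¬fx with compare-at v-inj (<⇒≢ (inject₁<suc i))
  ... | inj₁ asc = asc
  ... | inj₂ desc with compatible (inject₁<suc i) desc
  ...   | inj₁ sh = contradiction sh (fixed⇒¬shifted {f = f} {v (inject₁ i)} fx)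
  ...   | inj₂ fx′ = contradiction fx′ ¬fx

module _ {m} {g f₀ : Fin (suc m) → ℕ} {v w : Perm (suc m)} {bs : Bridges (suc m)} (i : Fin m)
    (v-asc : v (inject₁ i) Fin.< v (suc i)) (w-asc : w (inject₁ i) Fin.< w (suc i)) where

  cons-true : Built g f₀ (v ∘ s i) (w ∘ s i) bs → Built g f₀ v w bs
  cons-true b = record
    { expr = (i , true) ∷ expr ; positive = ascent⇒ℓ< v i v-asc , positive ; ascending = w-asc , ascending
    ; bridges≡ = bridges≡ ; final = final ; separated = separated }
    where open Built b

  cons-false : Built g f₀ v (w ∘ s i) bs → Built g f₀ v w (bs ∷ʳ (v (inject₁ i) , v (suc i)))
  cons-false b = record
    { expr = (i , false) ∷ expr ; positive = ascent⇒ℓ< v i v-asc , positive ; ascending = w-asc , ascending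
    ; bridges≡ = cong (_∷ʳ _) bridges≡ ; final = final ; separated = separated }
    where open Built b

-- The next letter when the last bridge (a , b) is to be removed: either a and b are adjacent, or two
-- neighbours weakly between them can be exchanged so as to bring a and b closer together.
module NextLetter {m} {g f′ : Fin (suc m) → ℕ} {v w : Perm (suc m)} {a b : Fin (suc m)}
    (bounded′ : Bounded f′) (bridge : ValidBridge f′ a b) (st : BuildState g v w (f′ ∘ transpose a b)) where
  open ValidBridge bridge
  open BuildState st
  open BridgeStep bounded′ a<b fb<fa renaming (f′ to f; bounded′ to bounded; f′-other to f-other)

  Swap Adjacent : Fin m → Set
  Swap i = v (inject₁ i) Fin.< v (suc i) × (Shifted f (v (suc i)) ⊎ Fixed f (v (inject₁ i)))
  Adjacent i = v (inject₁ i) ≡ a × v (suc i) ≡ b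

  ¬fixed¬shifted : ∀ c → c ≡ a ⊎ c ≡ b → ¬ (Shifted f c) × ¬ (Fixed f c)
  ¬fixed¬shifted c (inj₁ eq) = (λ sh → proj₁ (shifted′⁻ sh) eq) , (λ fx → proj₁ (fixed′⁻ fx) eq)
  ¬fixed¬shifted c (inj₂ eq) = (λ sh → proj₂ (shifted′⁻ sh) eq) , (λ fx → proj₂ (fixed′⁻ fx) eq)

  module _ {α β : Fin (suc m)} (vα : v α ≡ a) (vβ : v β ≡ b) where
    vα<vβ : v α Fin.< v β
    vα<vβ = subst₂ Fin._<_ (sym vα) (sym vβ) a<b

    -- Right after its bridge neither `a` nor `b` is a lollipop, so compatibility forbids `b` to
    -- stand before `a`.
    α<β : α Fin.< β
    α<β with ≢⇒<⊎> {x = α} {β} (λ { refl → ℕₚ.<-irrefl refl vα<vβ })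
    ... | inj₁ lt = lt
    ... | inj₂ gt with compatible gt vα<vβ
    ...   | inj₁ sh = contradiction sh (proj₁ (¬fixed¬shifted (v β) (inj₂ vβ)))
    ...   | inj₂ fx = contradiction fx (proj₂ (¬fixed¬shifted (v α) (inj₁ vα)))

    -- Colours `a` and the fixed lollipops. Where the colour drops, a fixed lollipop can move right,
    -- or the left neighbour is `a`; its right neighbour is then `b` or a shifted lollipop that can
    -- move left past `a`.
    col : Fin (suc m) → Bool
    col x = does (x Fin.≟ α) ∨ does (f (v x) ℕ.≟ toℕ (v x))

    col-false : ∀ x → col x ≡ false → x ≢ α × ¬ Fixed f (v x)
    col-false x eq =
      (λ x≡α → contradiction (trans (sym eq) (cong (_∨ does (f (v x) ℕ.≟ toℕ (v x))) (dec-true (x Fin.≟ α) x≡α))) λ ()) ,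
      (λ fx → contradiction (trans (sym eq) (trans (cong (does (x Fin.≟ α) ∨_) (dec-true (f (v x) ℕ.≟ toℕ (v x)) fx))
                                                   (Boolₚ.∨-zeroʳ (does (x Fin.≟ α))))) λ ())

    false-col : ∀ x → x ≢ α → ¬ Fixed f (v x) → col x ≡ false
    false-col x x≢α ¬fx rewrite dec-false (x Fin.≟ α) x≢α | dec-false (f (v x) ℕ.≟ toℕ (v x)) ¬fx = refl

    col-true : ∀ x → x ≢ α → col x ≡ true → Fixed f (v x)
    col-true x x≢α eq rewrite dec-false (x Fin.≟ α) x≢α = does-true (f (v x) ℕ.≟ toℕ (v x)) eq

    next-at : ∀ i → suc i Fin.≤ β → col (inject₁ i) ≡ true → col (suc i) ≡ false → Swap i ⊎ Adjacent i
    next-at i i<β c₁ c₂ = cases (inject₁ i Fin.≟ α) (suc i Fin.≟ β)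
      where
      ¬fx : ¬ Fixed f (v (suc i))
      ¬fx = proj₂ (col-false (suc i) c₂)
      cases : Dec (inject₁ i ≡ α) → Dec (suc i ≡ β) → Swap i ⊎ Adjacent i
      cases (no i≢α) _ = inj₁ (fixed-swap st i fx ¬fx , inj₂ fx)
        where fx = col-true (inject₁ i) i≢α c₁
      cases (yes refl) (yes refl) = inj₂ (vα , vβ)
      cases (yes refl) (no i≢β) = inj₁ (vα<d , inj₁ shifted)
        where
        vα<d : v α Fin.< v (suc i)
        vα<d with compare-at v-inj (<⇒≢ (inject₁<suc i))
        ... | inj₁ lt = lt
        ... | inj₂ gt with compatible (inject₁<suc i) gt
        ...   | inj₁ sh = contradiction sh (proj₁ (¬fixed¬shifted (v α) (inj₁ vα)))
        ...   | inj₂ fx = contradiction fx ¬fx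
        f≡f′ : f (v (suc i)) ≡ f′ (v (suc i))
        f≡f′ = f-other (λ eq → <⇒≢ vα<d (trans vα (sym eq))) (λ eq → i≢β (v-inj (trans eq (sym vβ))))
        shifted : Shifted f (v (suc i))
        -- If the right neighbour of `a` exceeds `b`, compatibility with `b` decides; otherwise it
        -- lies between `a` and `b`, and the validity of the bridge makes it a lollipop.
        shifted with compare-at v-inj i≢β
        ... | inj₂ vβ<d with compatible (ℕₚ.≤∧≢⇒< i<β (i≢β ∘ Finₚ.toℕ-injective)) vβ<d
        ...   | inj₁ sh = sh
        ...   | inj₂ fx = contradiction fx (proj₂ (¬fixed¬shifted (v β) (inj₂ vβ)))
        shifted | inj₁ d<vβ with lollipops (v (suc i)) (subst (Fin._< v (suc i)) vα vα<d) (subst (v (suc i) Fin.<_) vβ d<vβ)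
        ...   | inj₁ fx = contradiction (trans f≡f′ fx) ¬fx
        ...   | inj₂ sh = trans f≡f′ sh

    next′ : ∃ λ i → Swap i ⊎ Adjacent i
    next′ with find-drop (proj₁ (<⇒∃+ α<β)) col α β (proj₂ (<⇒∃+ α<β)) (cong (_∨ does (f (v α) ℕ.≟ toℕ (v α))) (dec-true (α Fin.≟ α) refl))
                 (false-col β (<⇒≢ α<β ∘ sym) (proj₂ (¬fixed¬shifted (v β) (inj₂ vβ))))
    ... | i , _ , i<β , c₁ , c₂ = i , next-at i i<β c₁ c₂

  next : ∃ λ i → Swap i ⊎ Adjacent i
  next = next′ (proj₂ (injective⇒surjective v-inj a)) (proj₂ (injective⇒surjective v-inj b))

  -- Undoing the bridge exchanges the labels at `i` and `suc i`, so `w` moves by the letter while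
  -- `v` stays. Compatibility persists because lollipops of `f` are lollipops of `f′`.
  remove-bridge : ∀ i → Adjacent i →
    v (inject₁ i) Fin.< v (suc i) × w (inject₁ i) Fin.< w (suc i) × BuildState g v (w ∘ s i) f′
  remove-bridge i (refl , refl) = a<b , proj₁ step , record
    { v-inj = v-inj ; w-inj = ∘-s-injective i w-inj
    ; compatible = λ x<y desc → [ inj₁ ∘ shifted′⇒shifted , inj₂ ∘ fixed′⇒fixed ]′ (compatible x<y desc)
    ; included = λ {x} {y} x<y desc → subst₂ _<_ (f-s y) (f-s x) (proj₂ step x<y desc)
    ; linked = λ x → trans (sym (f-s x)) (linked (s i x)) }
    where
    label< : f (v (inject₁ i)) < f (v (suc i))
    label< = subst₂ (λ p q → f′ p < f′ q) (sym (transpose-left a b)) (sym (transpose-right a b)) fb<fa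
    step = InvIncluded-s w-inj included i label<
    f-s : ∀ x → f (v (s i x)) ≡ f′ (v x)
    f-s x = cong f′ (trans (transpose-∘ v-inj i (s i x)) (cong v (s-involutive i x)))

module _ {m} {g f₀ : Fin (suc m) → ℕ} (bounded₀ : Bounded f₀) where

  -- Each exchange lengthens v, which bounds their number.
  private
    N : ℕ
    N = suc m * suc m

    ¬enough : ∀ (v : Perm (suc m)) i → N ≤ ℓ v → ¬ v (inject₁ i) Fin.< v (suc i)
    ¬enough v i enough asc =
      ℕₚ.1+n≰n (ℕₚ.≤-trans (subst (_≤ N) (ℓ-s-ascent v i asc) (inversions≤n² (v ∘ s i))) enough)

    still-enough : ∀ (v : Perm (suc m)) fuel i → v (inject₁ i) Fin.< v (suc i) → N ≤ suc fuel + ℓ v → N ≤ fuel + ℓ (v ∘ s i)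
    still-enough v fuel i asc = subst (N ≤_) (trans (sym (ℕₚ.+-suc fuel (ℓ v))) (cong (fuel +_) (sym (ℓ-s-ascent v i asc))))

  FixedDrop : Perm (suc m) → Fin m → Set
  FixedDrop v i = Fixed f₀ (v (inject₁ i)) × ¬ Fixed f₀ (v (suc i))

  fixedDrop? : ∀ v → Dec (∃ (FixedDrop v))
  fixedDrop? v = Finₚ.any? λ i → (f₀ (v (inject₁ i)) ℕ.≟ toℕ (v (inject₁ i))) ×-dec ¬? (f₀ (v (suc i)) ℕ.≟ toℕ (v (suc i)))

  noFixedDrop⇒separated : ∀ v → ¬ ∃ (FixedDrop v) → ∀ {x y} → x Fin.< y → Fixed f₀ (v x) → Fixed f₀ (v y)
  noFixedDrop⇒separated v none {x} {y} x<y fx with f₀ (v y) ℕ.≟ toℕ (v y)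
  ... | yes fy = fy
  ... | no ¬fy with find-drop _ (λ z → does (f₀ (v z) ℕ.≟ toℕ (v z))) x y (proj₂ (<⇒∃+ x<y))
                              (dec-true (f₀ (v x) ℕ.≟ toℕ (v x)) fx) (dec-false (f₀ (v y) ℕ.≟ toℕ (v y)) ¬fy)
  ...   | i , _ , _ , c₁ , c₂ = contradiction
    (i , does-true (f₀ (v (inject₁ i)) ℕ.≟ toℕ (v (inject₁ i))) c₁ , does-false (f₀ (v (suc i)) ℕ.≟ toℕ (v (suc i))) c₂) none

  -- With all bridges removed, the fixed lollipops are bubbled to the right by letters of 𝐮.
  separate : ∀ fuel {v w} → N ≤ fuel + ℓ v → BuildState g v w f₀ → Dec (∃ (FixedDrop v)) → Built g f₀ v w []
  separate fuel {v} enough st (no none) = record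
    { expr = [] ; positive = _ ; ascending = _ ; bridges≡ = refl ; final = st ; separated = noFixedDrop⇒separated v none }
  separate zero {v} enough st (yes (i , fx , ¬fx)) = contradiction (fixed-swap st i fx ¬fx) (¬enough v i enough)
  separate (suc fuel) {v} enough st (yes (i , fx , ¬fx)) =
    cons-true i asc (proj₁ step) (separate fuel (still-enough v fuel i asc enough) (proj₂ step) (fixedDrop? (v ∘ s i)))
    where
    asc = fixed-swap st i fx ¬fx
    step = swap-state st i bounded₀ asc (inj₂ fx)

  -- The construction for the earlier bridges enters as `continue`, since the `v` and `w` at which
  -- it starts emerge only from the exchanges.
  module _ {bs : Bridges (suc m)} {a b : Fin (suc m)} (bounded′ : Bounded (after f₀ bs)) (bridge : ValidBridge (after f₀ bs) a b)
      (continue : ∀ {v w} → BuildState g v w (after f₀ bs) → Built g f₀ v w bs) where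
    open ValidBridge bridge

    mutual
      approach : ∀ fuel {v w} → N ≤ fuel + ℓ v → BuildState g v w (after f₀ bs ∘ transpose a b) → Built g f₀ v w (bs ∷ʳ (a , b))
      approach fuel enough st = read-letter fuel enough st (NextLetter.next bounded′ bridge st)

      read-letter : ∀ fuel {v w} → N ≤ fuel + ℓ v → (st : BuildState g v w (after f₀ bs ∘ transpose a b)) →
        (∃ λ i → NextLetter.Swap bounded′ bridge st i ⊎ NextLetter.Adjacent bounded′ bridge st i) → Built g f₀ v w (bs ∷ʳ (a , b))
      read-letter fuel {v} {w} enough st (i , inj₂ adj) = subst (Built g f₀ v w)
        (cong₂ (λ p q → bs ∷ʳ (p , q)) (proj₁ adj) (proj₂ adj))
        (cons-false i (proj₁ removed) (proj₁ (proj₂ removed)) (continue (proj₂ (proj₂ removed))))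
        where removed = NextLetter.remove-bridge bounded′ bridge st i adj
      read-letter zero {v} enough st (i , inj₁ (asc , _)) = contradiction asc (¬enough v i enough)
      read-letter (suc fuel) {v} enough st (i , inj₁ (asc , allowed)) =
        cons-true i asc (proj₁ step) (approach fuel (still-enough v fuel i asc enough) (proj₂ step))
        where step = swap-state st i (BridgeStep.bounded′ bounded′ a<b fb<fa) asc allowed

  build : ∀ {bs} → Reverse bs → ValidBridges f₀ bs → ∀ {v w} → BuildState g v w (after f₀ bs) → Built g f₀ v w bs
  build [] valid {v} st = separate N (ℕₚ.m≤m+n N (ℓ v)) st (fixedDrop? v)
  build (bs ∶ rev ∶ʳ (a , b)) valid {v} {w} st = approach
    (after-bounded bs (proj₁ split) bounded₀) (proj₂ split) (build rev (proj₁ split))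
    N (ℕₚ.m≤m+n N (ℓ v)) (subst (BuildState g v w) (after-∷ʳ f₀ bs) st)
    where split = valid-∷ʳ⁻ bs valid

closed-count : ∀ {n} (p : Fin (suc n) → Bool) → (∀ {x y} → x Fin.< y → p y ≡ true → p x ≡ true) → p zero ≡ false →
               countFin (p ∘ suc) ≡ 0
closed-count p closed p₀ = count-false (p ∘ suc) λ y →
  Boolₚ.¬-not λ py → contradiction (trans (sym (closed {zero} {suc y} (s≤s z≤n) py)) p₀) λ ()

-- If 0 is absent, downward closure leaves the set empty; if it is present, removing it shifts
-- everything by one.
prefix-count : ∀ {n} (p : Fin n → Bool) → (∀ {x y} → x Fin.< y → p y ≡ true → p x ≡ true) →
               ∀ x → (p x ≡ true → toℕ x < countFin p) × (toℕ x < countFin p → p x ≡ true)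
prefix-count {suc n} p closed x with p zero in p₀
prefix-count {suc n} p closed zero | true = (λ _ → s≤s z≤n) , λ _ → p₀
prefix-count {suc n} p closed (suc x) | true with prefix-count (p ∘ suc) (closed ∘ s≤s) x
... | to , from = s≤s ∘ to , from ∘ ℕₚ.≤-pred
prefix-count {suc n} p closed zero | false = (λ px → contradiction (trans (sym px) p₀) λ ()) ,
  λ lt → contradiction (subst (0 <_) (closed-count p closed p₀) lt) λ ()
prefix-count {suc n} p closed (suc x) | false =
  (λ px → contradiction (trans (sym (closed {zero} (s≤s z≤n) px)) p₀) λ ()) ,
  λ lt → contradiction (subst (suc (toℕ x) <_) (closed-count p closed p₀) lt) λ ()

bridgeGraph⇒deodhar : ∀ {c ℓ′ : Level} (F : ACField₀ c ℓ′) {m k} (k≤n : k ≤ suc m) (B : BridgeGraph (suc m) k) →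
                      ∃ λ (D : DeodharDatum m k) → Param.SameMap F k≤n D B
bridgeGraph⇒deodhar F {m} {k} k≤n B =
  D , length≡ , λ t _ → FromDeodhar.sameRowSpan k≤n D I-inj lists F bridges (sym bridges≡) length≡ t
  where
  open BridgeGraph B
  f₀ g : Fin (suc m) → ℕ
  f₀ = lollipop I
  g = after f₀ bridges
  I-inj : Inj I
  I-inj = increasing⇒injective increasing
  start : BuildState g id id g
  start = record
    { v-inj = id ; w-inj = id ; compatible = λ x<y y<x → contradiction y<x (ℕₚ.<-asym x<y)
    ; included = λ x<y y<x → contradiction y<x (ℕₚ.<-asym x<y) ; linked = λ _ → refl }
  built : Built g f₀ id id bridges
  built = build (lollipop-bounded I) (reverseView bridges) valid start
  open Built built
  open BuildState final
  u w : Perm (suc m)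
  u = subProdFrom id expr
  w = wordProd (word expr)
  length≡ : length bridges ≡ nParams expr
  length≡ = trans (cong length (sym bridges≡)) (length-bridgesOf id expr)
  p : Fin (suc m) → Bool
  p x = does (Finₚ.any? λ r → I r Fin.≟ u x)
  p⇒∈ : ∀ x → p x ≡ true → ∃ λ r → I r ≡ u x
  p⇒∈ x = does-true (Finₚ.any? λ r → I r Fin.≟ u x)
  ∈⇒p : ∀ x → (∃ λ r → I r ≡ u x) → p x ≡ true
  ∈⇒p x = dec-true (Finₚ.any? λ r → I r Fin.≟ u x)
  closed : ∀ {x y} → x Fin.< y → p y ≡ true → p x ≡ true
  closed {x} {y} x<y py with ∈-image? I (u x)
  ... | inj₁ ux∈I = ∈⇒p x ux∈I
  ... | inj₂ ux∉I with p⇒∈ y py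
  ...   | r , eq = contradiction eq (lollipop-fixed⇒∉ I (separated x<y (lollipop-∉ I ux∉I)) r)
  position : ∀ r → ∃ λ x → u x ≡ I r
  position r = injective⇒surjective v-inj (I r)
  count≡k : countFin p ≡ k
  count≡k = count-image p {proj₁ ∘ position}
    (λ {r} {r′} eq → I-inj (trans (sym (proj₂ (position r))) (trans (cong u eq) (proj₂ (position r′)))))
    (λ r → ∈⇒p _ (r , sym (proj₂ (position r))))
    (λ x px → proj₁ (p⇒∈ x px) , v-inj (trans (proj₂ (position _)) (proj₂ (p⇒∈ x px))))
  ∈⇒<k : ∀ {x r} → I r ≡ u x → toℕ x < k
  ∈⇒<k {x} {r} eq = subst (toℕ x <_) count≡k (proj₁ (prefix-count p closed x) (∈⇒p x (r , eq)))
  <k⇒∈ : ∀ {x} → toℕ x < k → ∃ λ r → I r ≡ u x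
  <k⇒∈ {x} x<k = p⇒∈ x (proj₂ (prefix-count p closed x) (subst (toℕ x <_) (sym count≡k) x<k))
  shifted : ∀ {x} → toℕ x < k → Shifted f₀ (u x)
  shifted x<k = lollipop-∈ I (<k⇒∈ x<k)
  fixed : ∀ {x} → k ≤ toℕ x → Fixed f₀ (u x)
  fixed k≤x = lollipop-∉ I λ { (r , eq) → ℕₚ.<⇒≱ (∈⇒<k eq) k≤x }
  open Bounded (after-bounded bridges valid (lollipop-bounded I))
  criterion : Criterion k u w
  criterion = record
    -- By `linked`, `g (w x)` is the initial label of `u x`, namely u x + n before position `k` and
    -- u x from there on. The upper and the lower bound of `g` at `w x` then give the two
    -- inequalities.
    { raised   = λ {x} x<k → ℕₚ.+-cancelʳ-≤ (suc m) _ _ (subst (_≤ toℕ (w x) + suc m) (trans (sym (linked x)) (shifted x<k)) (≤upper (w x)))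
    ; lowered  = λ {x} k≤x → subst (toℕ (w x) ≤_) (trans (sym (linked x)) (fixed k≤x)) (lower≤ (w x))
    ; invBound = inv }
    where
    inv : InvBound k u w
    inv {x} {y} x<y desc with toℕ x ℕ.<? k | toℕ y ℕ.<? k
    ... | yes x<k | no  y≮k = inj₂ (x<k , ℕₚ.≮⇒≥ y≮k)
    ... | yes x<k | yes y<k = inj₁ (ℕₚ.+-cancelʳ-< (suc m) _ _ (subst₂ _<_ (shifted y<k) (shifted x<k) (included x<y desc)))
    ... | no  x≮k | yes y<k = contradiction (ℕₚ.<-trans x<y y<k) x≮k
    ... | no  x≮k | no  y≮k = inj₁ (subst₂ _<_ (fixed (ℕₚ.≮⇒≥ y≮k)) (fixed (ℕₚ.≮⇒≥ x≮k)) (included x<y desc))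
  D : DeodharDatum m k
  D = record
    { u = u ; w = w ; u≤kw = criterion⇒≤k v-inj w-inj criterion ; expr = expr ; isWord = λ _ → refl
    ; reduced = sym (trans (ascending⇒reduced (word expr) ascending) (cong (_+ length (word expr)) (ℓ-id (suc m))))
    ; pds = positive , λ _ → refl }
  lists : Lists k≤n u I
  lists = record
    { to = λ r → <k⇒∈ (subst (_< k) (sym (Finₚ.toℕ-inject≤ r k≤n)) (Finₚ.toℕ<n r))
    ; from = from }
    where
    from : ∀ r′ → ∃ λ r → u (inject≤ r k≤n) ≡ I r′
    from r′ with position r′
    ... | x , eq = Fin.fromℕ< x<k , trans (cong u (Finₚ.toℕ-injective (trans (Finₚ.toℕ-inject≤ _ k≤n) (Finₚ.toℕ-fromℕ< x<k)))) eq
      where x<k = ∈⇒<k (sym eq)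

theorem1p1 : ∀ {c ℓ′ : Level} (F : ACField₀ c ℓ′) (m k : ℕ) (k≤n : k ≤ suc m) →
    ((D : DeodharDatum m k) → ∃ λ (B : BridgeGraph (suc m) k) → Param.SameMap F k≤n D B) ×
    ((B : BridgeGraph (suc m) k) → ∃ λ (D : DeodharDatum m k) → Param.SameMap F k≤n D B)
theorem1p1 F m k k≤n = deodhar⇒bridgeGraph F k≤n , bridgeGraph⇒deodhar F k≤n
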